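{- Let $M=2s+3$ with $s\ge1$ and $q>8$ a power of $2$. Let $K$ be a complete $k$-arc in $PG(2,q)$ such that $K$ contains no point of the line $X_0=0$, $k<q-5$, $1\notin S_\infty(K)$, and $Y_2\ne Y_1^2$ for every point $(1,Y_1,Y_2)\in K$. Let $m_1,m_2\in\mathbb{F}_q^*$ with $m_1\ne m_2$, $(m_1+m_2)^3\ne1$, $m_1\ne 1$, $m_2\ne1$, $1\notin S_{m_1}(K)\cup S_{m_2}(K)$. Let $\mathcal{X}=(K:\mathcal{P}^s)\cup K_2(m_1,m_2)\subset PG(2s+2,q)$ and let $\bar{\mathcal{X}}$ be its image under $(x_0,\dots,x_{2s+2})\mapsto(0,x_0,\dots,x_{2s+2})$ in $PG(2s+3,q)$. Let $K_0=\{(1,1),(1,0)\}\subset PG(1,q)$. Then $(K_0:\mathcal{P}^{s+1})\cup\bar{\mathcal{X}}$ is a complete cap in $PG(M,q)$ of size $$2q^{\frac{M-1}{2}}+(k+3)q^{\frac{M-3}{2}}+3\sum_{j=1}^{(M-5)/2}q^j-M+4$$ (empty sum $=0$).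
   Context: A cap in $PG(N,q)$ is a set of points no three collinear; complete if not contained in a larger cap; an arc is a cap in $PG(2,q)$. Points of $K$ are written in normalized form (first nonzero coordinate $1$). $S_\infty(K)=\{X_2+Y_2:(X_0,X_1,X_2),(Y_0,Y_1,Y_2)\in K,X_0=Y_0,X_1=Y_1,X_2\ne Y_2\}$; $S_m(K)=\{X_1+Y_1:(X_0,X_1,X_2),(Y_0,Y_1,Y_2)\in K, X_0=Y_0, X_1\ne Y_1,\frac{X_2+Y_2}{X_1+Y_1}=m\}$. $\mathcal{P}^j=\{(a_1,a_1^2,\dots,a_j,a_j^2):a_i\in\mathbb{F}_q\}\subset\mathbb{F}_q^{2j}$. For points $C\subset PG(n,q)$ and $C'\subset\mathbb{F}_q^m$, $(C:C')=\{(x_0,\dots,x_n,y_1,\dots,y_m):(x_0,\dots,x_n)$ normalized form of a point of $C$, $(y_i)\in C'\}\subset PG(n+m,q)$. Define $K^{(1)}_{m_1,m_2}=\{(1,0),(0,1)\}\subset PG(1,q)$ and for $i\ge1$ $K^{(2i+1)}_{m_1,m_2}=A_1\cup A_2\cup A_3\cup\{(1,0,\dots,0)\}\subset PG(2i+1,q)$ with $A_1=\{(1,m_j,a_1,a_1^2,\dots,a_i,a_i^2):j\in\{1,2\},(a_1,\dots,a_i)\ne0\}$, $A_2=\{(0,1,a_1,a_1^2,\dots,a_i,a_i^2):(a_1,\dots,a_i)\ne0\}$, $A_3=\{(0,0,b_0,\dots,b_{2i-1}):(b_0,\dots,b_{2i-1})\in K^{(2i-1)}_{m_1,m_2}\}$.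 $K_2(m_1,m_2)$ is the image of $K^{(2s+1)}_{m_1,m_2}\setminus\{(1,0,\dots,0)\}$ under $(x_1,\dots,x_{2s+2})\mapsto(0,x_1,\dots,x_{2s+2})$ in $PG(2s+2,q)$. -}

module Defs where

open import Level using (0ℓ)
open import Data.Nat as ℕ using (ℕ; zero; suc)
open import Data.Product using (Σ; ∃; ∃-syntax; _×_; _,_)
open import Data.Sum using (_⊎_; inj₁; inj₂)
open import Data.Empty using (⊥)
open import Data.Vec using (Vec; []; _∷_; _++_; replicate; zipWith; map)
open import Data.List using (List; length)
open import Data.List.Membership.Propositional using (_∈_)
open import Data.List.Relation.Unary.Unique.Propositional using (Unique)
open import Relation.Nullary using (¬_)
open import Relation.Binary.PropositionalEquality using (_≡_; _≢_)
open import Relation.Binary.Definitions using (DecidableEquality)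
open import Algebra.Structures using (IsCommutativeRing)
open import Function.Bundles using (_⇔_)

HasSize : {A : Set} → (A → Set) → ℕ → Set
HasSize {A} S n = Σ (List A) λ xs → Unique xs × (∀ a → (a ∈ xs) ⇔ S a) × (length xs ≡ n)

-- The finite field F_q of characteristic 2 (q = 2^h, q elements).
-- F_q is unique up to isomorphism, so we quantify over all such fields.

record FiniteField2 (q : ℕ) : Set₁ where
  infixl 6 _+ᶠ_
  infixl 7 _*ᶠ_
  field
    Carrier  : Set
    _+ᶠ_ _*ᶠ_ : Carrier → Carrier → Carrier
    -ᶠ_       : Carrier → Carrier
    0# 1#    : Carrier
    isCommutativeRing : IsCommutativeRing _≡_ _+ᶠ_ _*ᶠ_ -ᶠ_ 0# 1#
    _≟_      : DecidableEquality Carrier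
    0≢1      : 0# ≢ 1#
    inverse  : ∀ x → x ≢ 0# → ∃[ y ] (x *ᶠ y ≡ 1#)
    char2    : 1# +ᶠ 1# ≡ 0#
    elements : List Carrier
    elements-unique   : Unique elements
    elements-complete : ∀ x → x ∈ elements
    elements-count    : length elements ≡ q

module Geometry {q : ℕ} (𝔽 : FiniteField2 q) where
  open FiniteField2 𝔽 public

  F : Set
  F = Carrier

  Normalized : ∀ {n} → Vec F n → Set
  Normalized []      = ⊥
  Normalized (x ∷ v) = (x ≡ 1#) ⊎ ((x ≡ 0#) × Normalized v)

  -- a set of points of PG(N,q): predicate on normalized vectors of length N+1
  PointSet : ℕ → Set₁
  PointSet N = Vec F (suc N) → Set

  IsPointSet : ∀ {N} → PointSet N → Set
  IsPointSet S = ∀ v → S v → Normalized v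

  _·_ : ∀ {n} → F → Vec F n → Vec F n
  a · v = map (a *ᶠ_) v

  _⊕_ : ∀ {n} → Vec F n → Vec F n → Vec F n
  _⊕_ = zipWith _+ᶠ_

  Collinear : ∀ {n} → Vec F n → Vec F n → Vec F n → Set
  Collinear X Y Z = Σ F λ a → Σ F λ b → Σ F λ c →
    ¬ (a ≡ 0# × b ≡ 0# × c ≡ 0#) × (((a · X) ⊕ (b · Y)) ⊕ (c · Z) ≡ replicate _ 0#)

  IsCap : ∀ {N} → PointSet N → Set
  IsCap S = IsPointSet S ×
    (∀ X Y Z → S X → S Y → S Z → X ≢ Y → Y ≢ Z → X ≢ Z → ¬ Collinear X Y Z)

  IsCompleteCap : ∀ {N} → PointSet N → Set₁
  IsCompleteCap {N} S = IsCap S ×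
    (∀ (T : PointSet N) → IsCap T → (∀ v → S v → T v) → ∀ v → T v → S v)

  InS∞ : PointSet 2 → F → Set
  InS∞ K c = ∃[ x0 ] ∃[ x1 ] ∃[ x2 ] ∃[ y0 ] ∃[ y1 ] ∃[ y2 ]
    K (x0 ∷ x1 ∷ x2 ∷ []) × K (y0 ∷ y1 ∷ y2 ∷ []) ×
    x0 ≡ y0 × x1 ≡ y1 × x2 ≢ y2 × c ≡ x2 +ᶠ y2

  -- S_m(K); the condition (X2+Y2)/(X1+Y1) = m is written X2+Y2 = m(X1+Y1),
  -- which is equivalent since X1+Y1 ≠ 0
  InSm : PointSet 2 → F → F → Set
  InSm K m c = ∃[ x0 ] ∃[ x1 ] ∃[ x2 ] ∃[ y0 ] ∃[ y1 ] ∃[ y2 ]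
    K (x0 ∷ x1 ∷ x2 ∷ []) × K (y0 ∷ y1 ∷ y2 ∷ []) ×
    x0 ≡ y0 × x1 ≢ y1 × (x2 +ᶠ y2 ≡ m *ᶠ (x1 +ᶠ y1)) × c ≡ x1 +ᶠ y1

  -- e j = 2j (defined recursively to get good definitional behaviour)
  e : ℕ → ℕ
  e zero    = zero
  e (suc j) = suc (suc (e j))

  sqVec : ∀ {j} → Vec F j → Vec F (e j)
  sqVec []      = []
  sqVec (a ∷ v) = a ∷ (a *ᶠ a) ∷ sqVec v

  InP : (j : ℕ) → Vec F (e j) → Set
  InP j y = ∃[ a ] (y ≡ sqVec {j} a)

  NonZeroVec : ∀ {j} → Vec F j → Set
  NonZeroVec {j} a = a ≢ replicate j 0#

  Join : ∀ {n m} → (Vec F (suc n) → Set) → (Vec F m → Set) → Vec F (suc n ℕ.+ m) → Set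
  Join {n} {m} C C' w = ∃[ x ] ∃[ y ] (w ≡ x ++ y) × C x × C' y

  Kodd : F → F → (i : ℕ) → Vec F (suc (suc (e i))) → Set
  Kodd m1 m2 zero v = (v ≡ 1# ∷ 0# ∷ []) ⊎ (v ≡ 0# ∷ 1# ∷ [])
  Kodd m1 m2 (suc i) v =
       (∃[ a ] NonZeroVec a × ((v ≡ 1# ∷ m1 ∷ sqVec {suc i} a) ⊎ (v ≡ 1# ∷ m2 ∷ sqVec {suc i} a)))
     ⊎ (∃[ a ] NonZeroVec a × (v ≡ 0# ∷ 1# ∷ sqVec {suc i} a))
     ⊎ (∃[ b ] Kodd m1 m2 i b × (v ≡ 0# ∷ 0# ∷ b))
     ⊎ (v ≡ 1# ∷ replicate _ 0#)

  K₂ : F → F → (s : ℕ) → Vec F (suc (suc (suc (e s)))) → Set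
  K₂ m1 m2 s w = ∃[ v ] Kodd m1 m2 s v × v ≢ 1# ∷ replicate _ 0# × (w ≡ 0# ∷ v)

  𝒳 : PointSet 2 → F → F → (s : ℕ) → Vec F (suc (suc (suc (e s)))) → Set
  𝒳 K m1 m2 s w = Join {2} {e s} K (InP s) w ⊎ K₂ m1 m2 s w

  𝒳bar : PointSet 2 → F → F → (s : ℕ) → Vec F (suc (suc (suc (suc (e s))))) → Set
  𝒳bar K m1 m2 s w = ∃[ x ] 𝒳 K m1 m2 s x × (w ≡ 0# ∷ x)

  K₀ : Vec F 2 → Set
  K₀ v = (v ≡ 1# ∷ 1# ∷ []) ⊎ (v ≡ 1# ∷ 0# ∷ [])

  FinalCap : PointSet 2 → F → F → (s : ℕ) → Vec F (suc (suc (suc (suc (e s))))) → Set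
  FinalCap K m1 m2 s w = Join {1} {e (suc s)} K₀ (InP (suc s)) w ⊎ 𝒳bar K m1 m2 s w

sumPow : ℕ → ℕ → ℕ
sumPow q zero    = 0
sumPow q (suc n) = sumPow q n ℕ.+ q ℕ.^ suc n

{-# OPTIONS --safe #-}
module Submission where

-- The cap is layered by the position of the leading 1.  In each layer the tail is a point
-- (a₁,a₁²,…) of 𝒫, and squaring is additive and bijective in characteristic 2.
--
-- Cap: a dependency among three points of one layer forces equal tails; one among two points of
-- a layer and a point Z of a lower layer says that Z is a multiple of a difference of the two.
-- Such a difference has tail sqVec u, and sqVec u = c · sqVec a with a ≠ 0 forces c = 1, which the
-- conditions on S∞, S_m, m₁, m₂ and Y₂ ≠ Y₁² exclude.
--
-- Completeness: if a, b and a + b are nonzero, then every tail is a · sqVec α ⊕ b · sqVec β.  Hence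
-- a point is covered as soon as its head is a suitable combination of two heads, provided that the
-- excluded values α = 0 and β = 0 do not occur; these mean zᵢ² = b wᵢ, resp. zᵢ² = a wᵢ, for all i.
-- A nonzero tail satisfies zᵢ² = c wᵢ for at most one c, which leaves enough secants to choose from.

open import Defs
open import Algebra.Bundles using (CommutativeRing)
open import Algebra.Solver.Ring.AlmostCommutativeRing using (fromCommutativeRing; _-Raw-AlmostCommutative⟶_)
import Algebra.Solver.Ring as RingSolver
open import Data.Bool using (Bool; true; false)
open import Data.Bool.Properties using (xor-∧-commutativeRing)
open import Data.Empty using (⊥; ⊥-elim)
open import Data.List as List using (List; []; _∷_; length; cartesianProduct)
import Data.List.Membership.DecPropositional as DecMembership
open import Data.List.Membership.Propositional using (_∈_)
open import Data.List.Membership.Propositional.Properties using (∈-map⁺; ∈-map⁻; ∈-++⁺ˡ; ∈-++⁺ʳ; ∈-++⁻; ∈-cartesianProduct⁺; ∈-cartesianProduct⁻)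
open import Data.List.Properties using (length-map; length-++)
open import Data.List.Relation.Unary.All as All using (All; []; _∷_)
open import Data.List.Relation.Unary.All.Properties using (¬Any⇒All¬)
open import Data.List.Relation.Unary.AllPairs using ([]; _∷_)
open import Data.List.Relation.Unary.Any as Any using (here; there)
open import Data.List.Relation.Unary.Unique.Propositional using (Unique)
import Data.List.Relation.Unary.Unique.Propositional.Properties as Unique
open import Data.Maybe using (Maybe; just; nothing)
open import Data.Nat using (ℕ; zero; suc; _+_; _*_; _∸_; _^_; _<_; _≤_; z≤n; s≤s)
import Data.Nat.Properties as ℕ
open import Data.Nat.Solver using (module +-*-Solver)
open import Data.Product using (Σ; ∃-syntax; _×_; _,_; proj₁; proj₂)
open import Data.Sum using (_⊎_; inj₁; inj₂; [_,_]′)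
open import Data.Unit using (⊤; tt)
open import Data.Vec using (Vec; _∷_; []; _++_; replicate; tail)
open import Data.Vec.Properties using (∷-injective; ++-injective; ++-injectiveˡ; ≡-dec)
open import Function using (_∘_)
open import Function.Bundles using (_⇔_; mk⇔; Equivalence)
open import Relation.Nullary using (¬_; Dec; yes; no; ¬?)
import Relation.Nullary.Decidable as Dec
open import Relation.Nullary.Decidable using (_×-dec_)
open import Relation.Binary.Definitions using (DecidableEquality)
open import Relation.Binary.PropositionalEquality using (_≡_; _≢_; refl; sym; trans; cong; cong₂; subst)

-- Two points of the top layer with equal second coordinate add up to `(0,0,sqVec u)`. So no point
-- of `Kodd` may be proportional to a vector `sqVec u`; conversely, points proportional to such a
-- vector are covered from the top layer, and coverage by the lowest layer only has to be shown up
-- to them. The point `(1,0,…,0)` is proportional to no `sqVec u`, yet it has to be left out of the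
-- outermost `Kodd`: `K` is complete and misses the line X₀ = 0, so `(0,1,0)` lies on a secant of
-- `K`, and lifting the two points of `K` with equal tails makes them collinear with
-- `(0,0,1,0,…,0)`. The same lifted secant covers the point once it is left out. Inner copies keep
-- their point `(1,0,…,0)`. Completeness of `K` speaks about all larger caps, so it yields a secant
-- only up to double negation. This is harmless: membership in the final cap is decidable, and
-- coverage is only used to refute that a larger cap contains a new point.

remove : {A : Set} {x : A} (ys : List A) → x ∈ ys →
  Σ (List A) λ zs → length ys ≡ suc (length zs) × (∀ y → y ∈ ys → y ≢ x → y ∈ zs)
remove (y ∷ ys) (here refl) = ys , refl , λ where
  z (here z≡x) z≢x → ⊥-elim (z≢x z≡x)
  z (there z∈) z≢x → z∈
remove (y ∷ ys) (there x∈) with remove ys x∈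
... | zs , eq , keep = y ∷ zs , cong suc eq , λ where
  z (here z≡y) z≢x → here z≡y
  z (there z∈) z≢x → there (keep z z∈ z≢x)

-- The pigeonhole principle. It makes squaring surjective and supplies field elements outside a
-- short list.
unique-⊆⇒length≤ : {A : Set} {xs ys : List A} → Unique xs → (∀ x → x ∈ xs → x ∈ ys) →
  length xs ≤ length ys
unique-⊆⇒length≤ [] sub = z≤n
unique-⊆⇒length≤ {xs = x ∷ xs} {ys} (x∉ ∷ u) sub with remove ys (sub x (here refl))
... | zs , eq , keep = subst (suc (length xs) ≤_) (sym eq)
  (s≤s (unique-⊆⇒length≤ u λ y y∈ → keep y (sub y (there y∈)) λ y≡x → All.lookup x∉ y∈ (sym y≡x)))

-- Sizes of sets given by predicates

module HasSizeProperties where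

  private
    variable
      A B : Set
      S T : A → Set
      m n : ℕ

  hasSize-⇔ : (∀ {a} → S a → T a) → (∀ {a} → T a → S a) → HasSize S n → HasSize T n
  hasSize-⇔ S⇒T T⇒S (xs , unique , mem , len) =
    xs , unique , (λ a → mk⇔ (S⇒T ∘ Equivalence.to (mem a)) (Equivalence.from (mem a) ∘ T⇒S)) , len

  hasSize-singleton : (x : A) → HasSize (_≡ x) 1
  hasSize-singleton x = x ∷ [] , [] ∷ [] , (λ a → mk⇔ (λ { (here p) → p ; (there ()) }) here) , refl

  hasSize-⊎ : (∀ {a} → S a → T a → ⊥) → HasSize S m → HasSize T n → HasSize (λ a → S a ⊎ T a) (m + n)
  hasSize-⊎ disjoint (xs , xs! , xs∈ , refl) (ys , ys! , ys∈ , refl) =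
    xs List.++ ys ,
    Unique.++⁺ xs! ys! (λ {a} (p , r) → disjoint (Equivalence.to (xs∈ a) p) (Equivalence.to (ys∈ a) r)) ,
    (λ a → mk⇔ ([ inj₁ ∘ Equivalence.to (xs∈ a) , inj₂ ∘ Equivalence.to (ys∈ a) ]′ ∘ ∈-++⁻ xs)
               [ ∈-++⁺ˡ ∘ Equivalence.from (xs∈ a) , ∈-++⁺ʳ xs ∘ Equivalence.from (ys∈ a) ]′) ,
    length-++ xs

  hasSize-image : {S : A → Set} (f : A → B) → (∀ {x y} → f x ≡ f y → x ≡ y) → HasSize S n →
    HasSize (λ b → ∃[ a ] S a × b ≡ f a) n
  hasSize-image f f-inj (xs , xs! , xs∈ , refl) =
    List.map f xs , Unique.map⁺ f-inj xs! ,
    (λ b → mk⇔ (λ p → let a , a∈ , b≡ = ∈-map⁻ f p in a , Equivalence.to (xs∈ a) a∈ , b≡)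
               (λ { (a , sa , refl) → ∈-map⁺ f (Equivalence.from (xs∈ a) sa) })) ,
    length-map f xs

  length-cartesianProduct : (xs : List A) (ys : List B) → length (cartesianProduct xs ys) ≡ length xs * length ys
  length-cartesianProduct []       ys = refl
  length-cartesianProduct (x ∷ xs) ys =
    trans (length-++ (List.map (x ,_) ys)) (cong₂ _+_ (length-map (x ,_) ys) (length-cartesianProduct xs ys))

  hasSize-× : HasSize S m → HasSize T n → HasSize (λ (a , b) → S a × T b) (m * n)
  hasSize-× (xs , xs! , xs∈ , refl) (ys , ys! , ys∈ , refl) =
    cartesianProduct xs ys , Unique.cartesianProduct⁺ xs! ys! ,
    (λ (a , b) → mk⇔
      (λ p → let a∈ , b∈ = ∈-cartesianProduct⁻ xs ys p in Equivalence.to (xs∈ a) a∈ , Equivalence.to (ys∈ b) b∈)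
      (λ (sa , tb) → ∈-cartesianProduct⁺ (Equivalence.from (xs∈ a) sa) (Equivalence.from (ys∈ b) tb))) ,
    length-cartesianProduct xs ys

  hasSize-remove : ∀ {x : A} → S x → HasSize S n → ∃[ m ] n ≡ suc m × HasSize (λ a → S a × a ≢ x) m
  hasSize-remove {A} {x = x} sx (xs , xs! , xs∈ , refl) =
    let ys , ys! , ys∈ , len = go xs xs! (Equivalence.from (xs∈ x) sx) in
    length ys , len , ys , ys! ,
    (λ a → mk⇔ (λ p → let a∈ , a≢x = Equivalence.to (ys∈ a) p in Equivalence.to (xs∈ a) a∈ , a≢x)
               (λ (sa , a≢x) → Equivalence.from (ys∈ a) (Equivalence.from (xs∈ a) sa , a≢x))) ,
    refl
    where
      go : ∀ xs → Unique xs → x ∈ xs →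
        Σ (List A) λ ys → Unique ys × (∀ a → a ∈ ys ⇔ (a ∈ xs × a ≢ x)) × length xs ≡ suc (length ys)
      go (_ ∷ xs) (x∉ ∷ xs!) (here refl) = xs , xs! ,
        (λ a → mk⇔ (λ a∈ → there a∈ , λ { refl → All.lookup x∉ a∈ refl })
                   (λ { (here refl , a≢x) → ⊥-elim (a≢x refl) ; (there a∈ , _) → a∈ })) , refl
      go (y ∷ xs) (y∉ ∷ xs!) (there x∈) with go xs xs! x∈
      ... | ys , ys! , ys∈ , len = y ∷ ys ,
        All.tabulate (λ {a} a∈ → All.lookup y∉ (proj₁ (Equivalence.to (ys∈ a) a∈))) ∷ ys! ,
        (λ a → mk⇔
          (λ { (here refl) → here refl , (λ { refl → All.lookup y∉ x∈ refl })
             ; (there a∈) → let a∈xs , a≢x = Equivalence.to (ys∈ a) a∈ in there a∈xs , a≢x })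
          (λ { (here a≡y , _) → here a≡y
             ; (there a∈ , a≢x) → there (Equivalence.from (ys∈ a) (a∈ , a≢x)) })) ,
        cong suc len

  hasSize⇒dec : {S : A → Set} → DecidableEquality A → HasSize S n → ∀ a → Dec (S a)
  hasSize⇒dec _≟_ (xs , _ , xs∈ , _) a = Dec.map (xs∈ a) (DecMembership._∈?_ _≟_ a xs)

open HasSizeProperties

-- The induction step for the size of `Kodd`: with `r` nonzero vectors, the two slopes contribute
-- `r + r`, the points starting with `(0,1)` contribute `r`, the inner copy `n`, and the leading
-- `suc` is the point `(1,0,…,0)`. Since `r` is one less than `Q`, each level loses 3 and gains 1,
-- hence the term `2 * i`, kept on the left to avoid subtraction.
odd-count : ∀ r n i P {Q} → Q ≡ suc r → n + 2 * i ≡ 3 * P + 2 →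
  suc (r + r + (r + n)) + 2 * suc i ≡ 3 * (P + Q) + 2
odd-count r n i P refl n≡ = trans
  (solve 3 (λ r n i → con 1 :+ (r :+ r :+ (r :+ n)) :+ con 2 :* (con 1 :+ i)
    := n :+ con 2 :* i :+ con 3 :* (con 1 :+ r)) refl r n i)
  (trans (cong (_+ 3 * suc r) n≡)
    (solve 2 (λ P Q → con 3 :* P :+ con 2 :+ con 3 :* Q := con 3 :* (P :+ Q) :+ con 2) refl P (suc r)))
  where open +-*-Solver

-- Here `R` and `Q` stand for the powers of q with exponents s + 1 and s, and `n` for the size of
-- `Kodd` without `(1,0,…,0)`. The top power `Q` of the geometric sum merges with `k * Q`, which
-- turns `k` into `k + 3`; the term -M is moved to the left as `2 * s + 3`.
final-count : ∀ s k n Q R P {R′} → R ≡ R′ → suc n + 2 * s ≡ 3 * (P + Q) + 2 →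
  R + R + (k * Q + n) + (2 * s + 3) ≡ 2 * R′ + (k + 3) * Q + 3 * P + 4
final-count s k n Q R P refl n≡ = trans
  (solve 5 (λ Q R k n s → R :+ R :+ (k :* Q :+ n) :+ (con 2 :* s :+ con 3)
    := con 2 :* R :+ k :* Q :+ con 2 :+ (con 1 :+ n :+ con 2 :* s)) refl Q R k n s)
  (trans (cong (2 * R + k * Q + 2 +_) n≡)
    (solve 4 (λ Q R k P → con 2 :* R :+ k :* Q :+ con 2 :+ (con 3 :* (P :+ Q) :+ con 2)
      := con 2 :* R :+ (k :+ con 3) :* Q :+ con 3 :* P :+ con 4) refl Q R k P))
  where open +-*-Solver

-- Field arithmetic in characteristic 2 and the affine conic

module Field {q : ℕ} (𝔽 : FiniteField2 q) where
  open Geometry 𝔽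

  commutativeRing : CommutativeRing _ _
  commutativeRing = record { isCommutativeRing = isCommutativeRing }

  private
    module R = CommutativeRing commutativeRing
    ACR = fromCommutativeRing commutativeRing

    fromBool : Bool → F
    fromBool false = 0#
    fromBool true  = 1#

    -1≡1 : 1# ≡ -ᶠ 1#
    -1≡1 = trans (sym (R.+-identityʳ 1#)) (trans (cong (1# +ᶠ_) (sym (R.-‿inverseʳ 1#)))
      (trans (sym (R.+-assoc 1# 1# (-ᶠ 1#))) (trans (cong (_+ᶠ -ᶠ 1#) char2) (R.+-identityˡ _))))

    -0≡0 : 0# ≡ -ᶠ 0#
    -0≡0 = trans (sym (R.-‿inverseʳ 0#)) (R.+-identityˡ _)

    -- Over the coefficient ring GF(2) the ring solver knows x + x = 0.
    morphism : CommutativeRing.rawRing xor-∧-commutativeRing -Raw-AlmostCommutative⟶ ACR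
    morphism = record
      { ⟦_⟧    = fromBool
      ; +-homo = λ { false y → sym (R.+-identityˡ _) ; true false → sym (R.+-identityʳ _) ; true true → sym char2 }
      ; *-homo = λ { false y → sym (R.zeroˡ _) ; true y → sym (R.*-identityˡ _) }
      ; -‿homo = λ { false → -0≡0 ; true → -1≡1 }
      ; 0-homo = refl
      ; 1-homo = refl
      }

    coeff≟ : ∀ x y → Maybe (fromBool x ≡ fromBool y)
    coeff≟ false false = just refl
    coeff≟ true  true  = just refl
    coeff≟ _     _     = nothing

  open RingSolver (CommutativeRing.rawRing xor-∧-commutativeRing) ACR morphism coeff≟ public
    using (solve; _:=_; _:+_; _:*_; con)

  x+y≡0⇒x≡y : ∀ {x y} → x +ᶠ y ≡ 0# → x ≡ y
  x+y≡0⇒x≡y {x} {y} p = trans (solve 2 (λ x y → x := (x :+ y) :+ y) refl x y)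
    (trans (cong (_+ᶠ y) p) (R.+-identityˡ y))

  x≡y⇒x+y≡0 : ∀ {x y} → x ≡ y → x +ᶠ y ≡ 0#
  x≡y⇒x+y≡0 {x} refl = solve 1 (λ x → x :+ x := con false) refl x

  1≢0 : 1# ≢ 0#
  1≢0 = 0≢1 ∘ sym

  x≢1⇒1+x≢0 : ∀ {x} → x ≢ 1# → 1# +ᶠ x ≢ 0#
  x≢1⇒1+x≢0 x≢1 p = x≢1 (sym (x+y≡0⇒x≡y p))

  x*0≡0 : ∀ x → x *ᶠ 0# ≡ 0#
  x*0≡0 = R.zeroʳ

  0*x≡0 : ∀ x → 0# *ᶠ x ≡ 0#
  0*x≡0 = R.zeroˡ

  x*1≡x : ∀ x → x *ᶠ 1# ≡ x
  x*1≡x = R.*-identityʳ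

  -- Proves x = y from a certificate x + y = h * k with h = 0.
  by₁ : ∀ {x y h} k → h ≡ 0# → x +ᶠ y ≡ h *ᶠ k → x ≡ y
  by₁ k h p = x+y≡0⇒x≡y (trans p (trans (cong (_*ᶠ k) h) (0*x≡0 k)))

  by₂ : ∀ {x y g h} k l → g ≡ 0# → h ≡ 0# → x +ᶠ y ≡ g *ᶠ k +ᶠ h *ᶠ l → x ≡ y
  by₂ {g = g} k l refl refl p = x+y≡0⇒x≡y
    (trans p (solve 2 (λ k l → con false :* k :+ con false :* l := con false) refl k l))

  by₃ : ∀ {x y g h i} k l m → g ≡ 0# → h ≡ 0# → i ≡ 0# →
    x +ᶠ y ≡ (g *ᶠ k +ᶠ h *ᶠ l) +ᶠ i *ᶠ m → x ≡ y
  by₃ k l m refl refl refl p = x+y≡0⇒x≡y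
    (trans p (solve 3 (λ k l m → (con false :* k :+ con false :* l) :+ con false :* m := con false) refl k l m))

  xy≡0⇒y≡0 : ∀ {x y} → x ≢ 0# → x *ᶠ y ≡ 0# → y ≡ 0#
  xy≡0⇒y≡0 {x} {y} x≢0 p with inverse x x≢0
  ... | x′ , xx′ = by₂ x′ y p (x≡y⇒x+y≡0 xx′)
    (solve 3 (λ x y x′ → y :+ con false := (x :* y) :* x′ :+ (x :* x′ :+ con true) :* y) refl x y x′)

  xy≢0 : ∀ {x y} → x ≢ 0# → y ≢ 0# → x *ᶠ y ≢ 0#
  xy≢0 x≢0 y≢0 p = y≢0 (xy≡0⇒y≡0 x≢0 p)

  x*y≢0⇒x≢0 : ∀ {x y z} → x *ᶠ y ≡ z → z ≢ 0# → x ≢ 0#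
  x*y≢0⇒x≢0 {y = y} p z≢0 refl = z≢0 (trans (sym p) (0*x≡0 y))

  x*y≢0⇒y≢0 : ∀ {x y z} → x *ᶠ y ≡ z → z ≢ 0# → y ≢ 0#
  x*y≢0⇒y≢0 {x} p z≢0 refl = z≢0 (trans (sym p) (x*0≡0 x))

  xx≡0⇒x≡0 : ∀ {x} → x *ᶠ x ≡ 0# → x ≡ 0#
  xx≡0⇒x≡0 {x} p with x ≟ 0#
  ... | yes x≡0 = x≡0
  ... | no  x≢0 = xy≡0⇒y≡0 x≢0 p

  square-injective : ∀ {x y} → x *ᶠ x ≡ y *ᶠ y → x ≡ y
  square-injective {x} {y} p = x+y≡0⇒x≡y (xx≡0⇒x≡0
    (trans (solve 2 (λ x y → (x :+ y) :* (x :+ y) := x :* x :+ y :* y) refl x y) (x≡y⇒x+y≡0 p)))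

  open import Data.List.Membership.DecPropositional _≟_ using (_∈?_)

  -- Squaring is injective on a finite set: a non-square `y` together with all squares would give q
  -- + 1 distinct elements.
  sqrt : ∀ y → ∃[ r ] r *ᶠ r ≡ y
  sqrt y with y ∈? List.map (λ x → x *ᶠ x) elements
  ... | yes y∈ = let r , _ , eq = ∈-map⁻ (λ x → x *ᶠ x) y∈ in r , sym eq
  ... | no  y∉ = ⊥-elim (ℕ.<-irrefl refl (subst (λ n → suc n ≤ length elements) (length-map _ elements)
          (unique-⊆⇒length≤ (¬Any⇒All¬ _ y∉ ∷ Unique.map⁺ square-injective elements-unique)
            λ x _ → elements-complete x)))

  avoid : (xs : List F) → length xs < q → ∃[ y ] All (y ≢_) xs
  avoid xs xs<q with Any.any? (λ y → ¬? (y ∈? xs)) elements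
  ... | yes p = let y , y∉ = Any.satisfied p in y , ¬Any⇒All¬ _ y∉
  ... | no ¬p = ⊥-elim (ℕ.<-irrefl refl (ℕ.<-≤-trans (subst (length xs <_) (sym elements-count) xs<q)
          (unique-⊆⇒length≤ elements-unique sub)))
    where
      sub : ∀ x → x ∈ elements → x ∈ xs
      sub x x∈ with x ∈? xs
      ... | yes x∈xs = x∈xs
      ... | no  x∉xs = ⊥-elim (¬p (Any.map (λ { refl → x∉xs }) x∈))

  -- z = aα + bβ and w = aα² + bβ² force b(a+b)β² = aw + z²,
  -- so β is a square root and α is then linear in β.
  split-coordinate : ∀ {a b} → a ≢ 0# → b ≢ 0# → a +ᶠ b ≢ 0# → ∀ z w →
    ∃[ α ] ∃[ β ] z ≡ a *ᶠ α +ᶠ b *ᶠ β × w ≡ a *ᶠ (α *ᶠ α) +ᶠ b *ᶠ (β *ᶠ β)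
  split-coordinate {a} {b} a≢0 b≢0 a+b≢0 z w
    with inverse a a≢0 | inverse (b *ᶠ (a +ᶠ b)) (xy≢0 b≢0 a+b≢0)
  ... | a′ , aa′ | k , bk with sqrt ((a *ᶠ w +ᶠ z *ᶠ z) *ᶠ k)
  ... | β , ββ = (z +ᶠ b *ᶠ β) *ᶠ a′ , β
    , by₁ (z +ᶠ b *ᶠ β) (x≡y⇒x+y≡0 aa′)
        (solve 5 (λ a a′ b z β → z :+ (a :* ((z :+ b :* β) :* a′) :+ b :* β)
          := (a :* a′ :+ con true) :* (z :+ b :* β)) refl a a′ b z β)
    , by₃ (a′ *ᶠ (z *ᶠ z +ᶠ b *ᶠ b *ᶠ (β *ᶠ β)) +ᶠ b *ᶠ (β *ᶠ β) +ᶠ w)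
        (a′ *ᶠ b *ᶠ (a +ᶠ b)) (a′ *ᶠ (a *ᶠ w +ᶠ z *ᶠ z))
        (x≡y⇒x+y≡0 aa′) (x≡y⇒x+y≡0 ββ) (x≡y⇒x+y≡0 bk)
        (solve 7 (λ a a′ b z w β k →
          w :+ (a :* (((z :+ b :* β) :* a′) :* ((z :+ b :* β) :* a′)) :+ b :* (β :* β))
          := ((a :* a′ :+ con true) :* (a′ :* (z :* z :+ b :* b :* (β :* β)) :+ b :* (β :* β) :+ w)
             :+ (β :* β :+ (a :* w :+ z :* z) :* k) :* (a′ :* b :* (a :+ b)))
             :+ (b :* (a :+ b) :* k :+ con true) :* (a′ :* (a :* w :+ z :* z)))
          refl a a′ b z w β k)

  -- The quadratic (x + α)(x + γ) vanishes at α and γ, so only β contributes.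
  conic-pair : ∀ {a b c α β γ} → b ≢ 0# → a +ᶠ b +ᶠ c ≡ 0# →
    a *ᶠ α +ᶠ b *ᶠ β +ᶠ c *ᶠ γ ≡ 0# →
    a *ᶠ (α *ᶠ α) +ᶠ b *ᶠ (β *ᶠ β) +ᶠ c *ᶠ (γ *ᶠ γ) ≡ 0# →
    β ≢ γ → α ≡ β
  conic-pair {a} {b} {c} {α} {β} {γ} b≢0 p₀ p₁ p₂ β≢γ =
    x+y≡0⇒x≡y (xy≡0⇒y≡0 (λ p → β≢γ (x+y≡0⇒x≡y p)) (xy≡0⇒y≡0 b≢0
      (by₃ (α *ᶠ γ) (α +ᶠ γ) 1# p₀ p₁ p₂
        (solve 6 (λ a b c α β γ → b :* ((β :+ γ) :* (α :+ β)) :+ con false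
          := ((a :+ b :+ c) :* (α :* γ) :+ (a :* α :+ b :* β :+ c :* γ) :* (α :+ γ))
             :+ (a :* (α :* α) :+ b :* (β :* β) :+ c :* (γ :* γ)) :* con true)
          refl a b c α β γ))))

  rotate-sum : ∀ {x y z} → x +ᶠ y +ᶠ z ≡ 0# → y +ᶠ z +ᶠ x ≡ 0#
  rotate-sum {x} {y} {z} p = trans (solve 3 (λ x y z → y :+ z :+ x := x :+ y :+ z) refl x y z) p

  -- A Vandermonde argument: the weights annihilate 1, x and x². If some pair differs, `conic-pair`,
  -- applied after a suitable rotation, forces an equality that contradicts the case at hand.
  conic-independent : ∀ {a b c α β γ} → a ≢ 0# → b ≢ 0# → c ≢ 0# → a +ᶠ b +ᶠ c ≡ 0# →
    a *ᶠ α +ᶠ b *ᶠ β +ᶠ c *ᶠ γ ≡ 0# →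
    a *ᶠ (α *ᶠ α) +ᶠ b *ᶠ (β *ᶠ β) +ᶠ c *ᶠ (γ *ᶠ γ) ≡ 0# →
    α ≡ β × β ≡ γ
  conic-independent {α = α} {β} {γ} a≢0 b≢0 c≢0 p₀ p₁ p₂ with β ≟ γ | α ≟ β
  ... | yes refl | yes refl = refl , refl
  ... | yes refl | no α≢β =
    ⊥-elim (α≢β (sym (conic-pair a≢0 (rotate-sum (rotate-sum p₀)) (rotate-sum (rotate-sum p₁))
      (rotate-sum (rotate-sum p₂)) α≢β)))
  ... | no β≢γ | yes refl = ⊥-elim (β≢γ (conic-pair c≢0 (rotate-sum p₀) (rotate-sum p₁) (rotate-sum p₂) (β≢γ ∘ sym)))
  ... | no β≢γ | no α≢β = ⊥-elim (α≢β (conic-pair b≢0 p₀ p₁ p₂ β≢γ))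

-- Linear dependencies, caps and secants

module Vectors {q : ℕ} (𝔽 : FiniteField2 q) where
  open Geometry 𝔽
  open Field 𝔽

  0ᵛ : ∀ {n} → Vec F n
  0ᵛ = replicate _ 0#

  _≟ᵛ_ : ∀ {n} (X Y : Vec F n) → Dec (X ≡ Y)
  _≟ᵛ_ = ≡-dec _≟_

  infix 4 _≟ᵛ_

  comb₃ : ∀ {n} → F → F → F → Vec F n → Vec F n → Vec F n → Vec F n
  comb₃ a b c X Y Z = ((a · X) ⊕ (b · Y)) ⊕ (c · Z)

  0·X≡0 : ∀ {n} (X : Vec F n) → 0# · X ≡ 0ᵛ
  0·X≡0 []      = refl
  0·X≡0 (x ∷ X) = cong₂ _∷_ (0*x≡0 x) (0·X≡0 X)

  1·X≡X : ∀ {n} (X : Vec F n) → 1# · X ≡ X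
  1·X≡X []      = refl
  1·X≡X (x ∷ X) = cong₂ _∷_ (solve 1 (λ x → con true :* x := x) refl x) (1·X≡X X)

  a·0≡0 : ∀ n a → a · (0ᵛ {n}) ≡ 0ᵛ
  a·0≡0 zero    a = refl
  a·0≡0 (suc n) a = cong₂ _∷_ (x*0≡0 a) (a·0≡0 n a)

  a·X≡0⇒X≡0 : ∀ {n a} (X : Vec F n) → a ≢ 0# → a · X ≡ 0ᵛ → X ≡ 0ᵛ
  a·X≡0⇒X≡0 []      a≢0 p = refl
  a·X≡0⇒X≡0 (x ∷ X) a≢0 p with ∷-injective p
  ... | p₀ , p₁ = cong₂ _∷_ (xy≡0⇒y≡0 a≢0 p₀) (a·X≡0⇒X≡0 X a≢0 p₁)

  X⊕Y≡0⇒X≡Y : ∀ {n} (X Y : Vec F n) → X ⊕ Y ≡ 0ᵛ → X ≡ Y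
  X⊕Y≡0⇒X≡Y []      []      p = refl
  X⊕Y≡0⇒X≡Y (x ∷ X) (y ∷ Y) p with ∷-injective p
  ... | p₀ , p₁ = cong₂ _∷_ (x+y≡0⇒x≡y p₀) (X⊕Y≡0⇒X≡Y X Y p₁)

  X⊕X≡0 : ∀ {n} (X : Vec F n) → X ⊕ X ≡ 0ᵛ
  X⊕X≡0 []      = refl
  X⊕X≡0 (x ∷ X) = cong₂ _∷_ (x≡y⇒x+y≡0 refl) (X⊕X≡0 X)

  X⊕0≡X : ∀ {n} (X : Vec F n) → X ⊕ 0ᵛ ≡ X
  X⊕0≡X []      = refl
  X⊕0≡X (x ∷ X) = cong₂ _∷_ (solve 1 (λ x → x :+ con false := x) refl x) (X⊕0≡X X)

  0⊕X≡X : ∀ {n} (X : Vec F n) → 0ᵛ ⊕ X ≡ X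
  0⊕X≡X []      = refl
  0⊕X≡X (x ∷ X) = cong₂ _∷_ (solve 1 (λ x → con false :+ x := x) refl x) (0⊕X≡X X)

  +-distrib-· : ∀ {n} a b (X : Vec F n) → (a +ᶠ b) · X ≡ (a · X) ⊕ (b · X)
  +-distrib-· a b []      = refl
  +-distrib-· a b (x ∷ X) =
    cong₂ _∷_ (solve 3 (λ a b x → (a :+ b) :* x := a :* x :+ b :* x) refl a b x) (+-distrib-· a b X)

  rotate : ∀ {n} (X Y Z : Vec F n) → (X ⊕ Y) ⊕ Z ≡ 0ᵛ → (Y ⊕ Z) ⊕ X ≡ 0ᵛ
  rotate []      []      []      p = refl
  rotate (x ∷ X) (y ∷ Y) (z ∷ Z) p with ∷-injective p
  ... | p₀ , p₁ = cong₂ _∷_ (rotate-sum p₀) (rotate X Y Z p₁)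

  -- In characteristic 2, `a + b = 0` means `a = b`, so dividing the dependency by `a` leaves
  -- exactly `X ⊕ Y`.
  pair-sum : ∀ {n a b c} (X Y Z : Vec F n) → a ≢ 0# → c ≢ 0# → a +ᶠ b ≡ 0# →
    comb₃ a b c X Y Z ≡ 0ᵛ → ∃[ d ] d ≢ 0# × X ⊕ Y ≡ d · Z
  pair-sum {a = a} {b} {c} X Y Z a≢0 c≢0 a+b eq with inverse a a≢0
  ... | a′ , aa′ = c *ᶠ a′ , xy≢0 c≢0 (x*y≢0⇒y≢0 aa′ 1≢0) , go X Y Z eq
    where
      go : ∀ {n} (X Y Z : Vec F n) → comb₃ a b c X Y Z ≡ 0ᵛ → X ⊕ Y ≡ (c *ᶠ a′) · Z
      go []      []      []      p = refl
      go (x ∷ X) (y ∷ Y) (z ∷ Z) p with ∷-injective p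
      ... | p₀ , p₁ = cong₂ _∷_
        (by₃ a′ (x +ᶠ y) (a′ *ᶠ y) p₀ (x≡y⇒x+y≡0 aa′) a+b
          (solve 7 (λ a a′ b c x y z → x :+ y :+ c :* a′ :* z
            := ((a :* x :+ b :* y :+ c :* z) :* a′ :+ (a :* a′ :+ con true) :* (x :+ y))
               :+ (a :+ b) :* (a′ :* y)) refl a a′ b c x y z))
        (go X Y Z p₁)

  solve-for : ∀ {n a b c} (X Y Z : Vec F n) → a ≢ 0# → comb₃ a b c X Y Z ≡ 0ᵛ →
    ∃[ d ] ∃[ f ] X ≡ (d · Y) ⊕ (f · Z)
  solve-for {a = a} {b} {c} X Y Z a≢0 eq with inverse a a≢0
  ... | a′ , aa′ = b *ᶠ a′ , c *ᶠ a′ , go X Y Z eq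
    where
      go : ∀ {n} (X Y Z : Vec F n) → comb₃ a b c X Y Z ≡ 0ᵛ → X ≡ ((b *ᶠ a′) · Y) ⊕ ((c *ᶠ a′) · Z)
      go []      []      []      p = refl
      go (x ∷ X) (y ∷ Y) (z ∷ Z) p with ∷-injective p
      ... | p₀ , p₁ = cong₂ _∷_
        (by₂ a′ x p₀ (x≡y⇒x+y≡0 aa′)
          (solve 7 (λ a a′ b c x y z → x :+ (b :* a′ :* y :+ c :* a′ :* z)
            := (a :* x :+ b :* y :+ c :* z) :* a′ :+ (a :* a′ :+ con true) :* x) refl a a′ b c x y z))
        (go X Y Z p₁)

  normalized≢0 : ∀ {n} {X : Vec F n} → Normalized X → X ≢ 0ᵛ
  normalized≢0 {X = x ∷ X} (inj₁ refl)      p = 1≢0 (proj₁ (∷-injective p))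
  normalized≢0 {X = x ∷ X} (inj₂ (_ , norm)) p = normalized≢0 norm (proj₂ (∷-injective p))

  normalized-scale : ∀ {n d} {X Y : Vec F n} → Normalized X → Normalized Y → X ≡ d · Y → X ≡ Y
  normalized-scale {d = d} {x ∷ X} {y ∷ Y} (inj₁ refl) (inj₁ refl) p with ∷-injective p
  ... | p₀ , p₁ = cong (1# ∷_) (trans p₁ (trans (cong (_· Y) (sym (trans p₀ (x*1≡x d)))) (1·X≡X Y)))
  normalized-scale {d = d} {x ∷ X} {y ∷ Y} (inj₁ refl) (inj₂ (refl , _)) p =
    ⊥-elim (1≢0 (trans (proj₁ (∷-injective p)) (x*0≡0 d)))
  normalized-scale {d = d} {x ∷ X} {y ∷ Y} (inj₂ (refl , nX)) (inj₁ refl) p with ∷-injective p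
  ... | p₀ , p₁ = ⊥-elim (normalized≢0 nX
    (trans p₁ (trans (cong (_· Y) (sym (trans p₀ (x*1≡x d)))) (0·X≡0 Y))))
  normalized-scale {d = d} {x ∷ X} {y ∷ Y} (inj₂ (refl , nX)) (inj₂ (refl , nY)) p =
    cong (0# ∷_) (normalized-scale nX nY (proj₂ (∷-injective p)))

  proportional : ∀ {n a b} (X Y : Vec F n) → a ≢ 0# → (a · X) ⊕ (b · Y) ≡ 0ᵛ → ∃[ d ] X ≡ d · Y
  proportional {a = a} {b} X Y a≢0 eq
    with solve-for {a = a} {b} {0#} X Y Y a≢0 (trans (cong (((a · X) ⊕ (b · Y)) ⊕_) (0·X≡0 Y)) (trans (X⊕0≡X _) eq))
  ... | d , f , p = d +ᶠ f , trans p (sym (+-distrib-· d f Y))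

  coefficient≢0 : ∀ {n a b c} {X Y Z : Vec F n} → Normalized Y → Normalized Z → Y ≢ Z →
    ¬ (a ≡ 0# × b ≡ 0# × c ≡ 0#) → comb₃ a b c X Y Z ≡ 0ᵛ → a ≢ 0#
  coefficient≢0 {b = b} {c} {X} {Y} {Z} nY nZ Y≢Z nonzero eq refl = absurd (b ≟ 0#)
    where
      eq′ : (b · Y) ⊕ (c · Z) ≡ 0ᵛ
      eq′ = trans (sym (cong (_⊕ (c · Z)) (trans (cong (_⊕ (b · Y)) (0·X≡0 X)) (0⊕X≡X _)))) eq

      absurd : Dec (b ≡ 0#) → ⊥
      absurd (no b≢0) = Y≢Z (normalized-scale nY nZ (proj₂ (proportional Y Z b≢0 eq′)))
      absurd (yes b≡0) = normalized≢0 nZ (a·X≡0⇒X≡0 Z (λ c≡0 → nonzero (refl , b≡0 , c≡0))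
        (trans (sym (X⊕Y≡0⇒X≡Y _ _ eq′)) (trans (cong (_· Y) b≡0) (0·X≡0 Y))))

  -- Unlike `Collinear`, this asks for three nonzero coefficients. For distinct normalized points
  -- that is no loss: by `coefficient≢0`, a vanishing coefficient would make two of them
  -- proportional, hence equal.
  NoThree : ∀ {n} → (Vec F n → Set) → Set
  NoThree S = ∀ {X Y Z} → S X → S Y → S Z → X ≢ Y → Y ≢ Z → X ≢ Z →
    ∀ {a b c} → a ≢ 0# → b ≢ 0# → c ≢ 0# → comb₃ a b c X Y Z ≢ 0ᵛ

  noThree⇒isCap : ∀ {N} {S : PointSet N} → IsPointSet S → NoThree S → IsCap S
  noThree⇒isCap pts noThree = pts , λ X Y Z sX sY sZ X≢Y Y≢Z X≢Z (a , b , c , nonzero , eq) →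
    let eq₂ = rotate (a · X) (b · Y) (c · Z) eq in
    let eq₃ = rotate (b · Y) (c · Z) (a · X) eq₂ in
    noThree sX sY sZ X≢Y Y≢Z X≢Z
      (coefficient≢0 (pts Y sY) (pts Z sZ) Y≢Z nonzero eq)
      (coefficient≢0 (pts Z sZ) (pts X sX) (X≢Z ∘ sym) (λ (b≡0 , c≡0 , a≡0) → nonzero (a≡0 , b≡0 , c≡0)) eq₂)
      (coefficient≢0 (pts X sX) (pts Y sY) X≢Y (λ (c≡0 , a≡0 , b≡0) → nonzero (a≡0 , b≡0 , c≡0)) eq₃)
      eq

  isCap⇒noThree : ∀ {N} {S : PointSet N} → IsCap S → NoThree S
  isCap⇒noThree (_ , cap) {X} {Y} {Z} sX sY sZ X≢Y Y≢Z X≢Z a≢0 b≢0 c≢0 eq =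
    cap X Y Z sX sY sZ X≢Y Y≢Z X≢Z (_ , _ , _ , (λ (a≡0 , _) → a≢0 a≡0) , eq)

  Covered : ∀ {n} → (Vec F n → Set) → Vec F n → Set
  Covered S v = ∃[ X ] ∃[ Y ] S X × S Y × X ≢ Y × ∃[ a ] ∃[ b ] v ≡ (a · X) ⊕ (b · Y)

  covered-map : ∀ {m n} {S : Vec F m → Set} {T : Vec F n → Set} (f : Vec F m → Vec F n) →
    (∀ {X Y} → f X ≡ f Y → X ≡ Y) → (∀ {X} → S X → T (f X)) →
    (∀ a b X Y → f ((a · X) ⊕ (b · Y)) ≡ (a · f X) ⊕ (b · f Y)) →
    ∀ {v} → Covered S v → Covered T (f v)
  covered-map f f-inj S⇒T linear (X , Y , sX , sY , X≢Y , a , b , v≡) =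
    f X , f Y , S⇒T sX , S⇒T sY , X≢Y ∘ f-inj , a , b , trans (cong f v≡) (linear a b X Y)

  covered⇒collinear : ∀ {n} (v X Y : Vec F n) a b → v ≡ (a · X) ⊕ (b · Y) → Collinear v X Y
  covered⇒collinear v X Y a b eq = 1# , a , b , (λ (p , _) → 1≢0 p) , go v X Y eq
    where
      go : ∀ {n} (v X Y : Vec F n) → v ≡ (a · X) ⊕ (b · Y) → comb₃ 1# a b v X Y ≡ 0ᵛ
      go []      []      []      p = refl
      go (v ∷ V) (x ∷ X) (y ∷ Y) p with ∷-injective p
      ... | p₀ , p₁ = cong₂ _∷_
        (by₁ 1# (x≡y⇒x+y≡0 p₀)
          (solve 5 (λ v a x b y → con true :* v :+ a :* x :+ b :* y :+ con false
            := (v :+ (a :* x :+ b :* y)) :* con true) refl v a x b y))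
        (go V X Y p₁)

  -- Once `v` is known to lie outside `S`, the goal is a contradiction, so doubly negated coverage
  -- is enough.
  complete-from-coverage : ∀ {N} {S : PointSet N} → IsCap S → (∀ v → Dec (S v)) →
    (∀ v → Normalized v → ¬ S v → ¬ ¬ Covered S v) → IsCompleteCap S
  complete-from-coverage {S = S} cap S? cover = cap , maximal
    where
      maximal : ∀ T → IsCap T → (∀ v → S v → T v) → ∀ v → T v → S v
      maximal T (pts , capT) S⊆T v tv with S? v
      ... | yes sv = sv
      ... | no ¬sv = ⊥-elim (cover v (pts v tv) ¬sv λ (X , Y , sX , sY , X≢Y , a , b , v≡) →
        capT v X Y tv (S⊆T X sX) (S⊆T Y sY) (λ { refl → ¬sv sX }) X≢Y (λ { refl → ¬sv sY })
          (covered⇒collinear v X Y a b v≡))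

  -- If no secant of `S` passes through `v`, then adjoining `v` gives a cap again, and maximality
  -- puts `v` into `S`.
  complete⇒covered : ∀ {N} {S : PointSet N} → IsCompleteCap S →
    ∀ v → Normalized v → ¬ S v → ¬ ¬ Covered S v
  complete⇒covered {N} {S} (cap@(pts , _) , maximal) v nv ¬sv ¬cov =
    ¬sv (maximal T (noThree⇒isCap ptsT noThreeT) (λ _ → inj₁) v (inj₂ refl))
    where
      T : PointSet N
      T w = S w ⊎ w ≡ v

      ptsT : IsPointSet T
      ptsT w (inj₁ sw)   = pts w sw
      ptsT w (inj₂ refl) = nv

      on-secant : ∀ {a b c X Y} → S X → S Y → X ≢ Y → a ≢ 0# → comb₃ a b c v X Y ≢ 0ᵛ
      on-secant {X = X} {Y} sX sY X≢Y a≢0 eq =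
        ¬cov (X , Y , sX , sY , X≢Y , solve-for v X Y a≢0 eq)

      noThreeT : NoThree T
      noThreeT (inj₁ sX) (inj₁ sY) (inj₁ sZ) = isCap⇒noThree cap sX sY sZ
      noThreeT (inj₂ refl) (inj₁ sY) (inj₁ sZ) _ Y≢Z _ a≢0 _ _ eq = on-secant sY sZ Y≢Z a≢0 eq
      noThreeT {X} {Y} {Z} (inj₁ sX) (inj₂ refl) (inj₁ sZ) _ _ X≢Z {a} {b} {c} _ b≢0 _ eq =
        on-secant sZ sX (X≢Z ∘ sym) b≢0 (rotate (a · X) (b · Y) (c · Z) eq)
      noThreeT {X} {Y} {Z} (inj₁ sX) (inj₁ sY) (inj₂ refl) X≢Y _ _ {a} {b} {c} _ _ c≢0 eq =
        on-secant sX sY X≢Y c≢0 (rotate (b · Y) (c · Z) (a · X) (rotate (a · X) (b · Y) (c · Z) eq))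
      noThreeT (inj₂ refl) (inj₂ refl) _ X≢Y = ⊥-elim (X≢Y refl)
      noThreeT (inj₁ _) (inj₂ refl) (inj₂ refl) _ Y≢Z = ⊥-elim (Y≢Z refl)
      noThreeT (inj₂ refl) (inj₁ _) (inj₂ refl) _ _ X≢Z = ⊥-elim (X≢Z refl)

  -- Layers by leading coordinate

  Stack : ∀ {n} → (Vec F n → Set) → (Vec F n → Set) → Vec F (suc n) → Set
  Stack A B v = (∃[ x ] A x × v ≡ 1# ∷ x) ⊎ (∃[ x ] B x × v ≡ 0# ∷ x)

  -- The condition `a + b + c = 0` is the contribution of the leading coordinate 1 that the points
  -- of a layer share.
  AffinelyIndependent : ∀ {n} → (Vec F n → Set) → Set
  AffinelyIndependent A = ∀ {X Y Z} → A X → A Y → A Z → X ≢ Y → Y ≢ Z → X ≢ Z →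
    ∀ {a b c} → a ≢ 0# → b ≢ 0# → c ≢ 0# → a +ᶠ b +ᶠ c ≡ 0# → comb₃ a b c X Y Z ≢ 0ᵛ

  -- For `X ≠ Y`, the vector `X ⊕ Y` represents the point at infinity of the line joining `(1,X)`
  -- and `(1,Y)`.
  NoDirection : ∀ {n} → (Vec F n → Set) → (Vec F n → Set) → Set
  NoDirection A B = ∀ {X Y Z} → A X → A Y → B Z → ∀ {c} → c ≢ 0# → X ⊕ Y ≢ c · Z

  noThree-⊆ : ∀ {n} {S T : Vec F n → Set} → (∀ {v} → S v → T v) → NoThree T → NoThree S
  noThree-⊆ S⊆T noThree sX sY sZ = noThree (S⊆T sX) (S⊆T sY) (S⊆T sZ)

  -- Sort a dependency by how many of its points lie in the upper layer. Exactly one is impossible,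
  -- since the leading coordinate would make its coefficient zero; three, two and none are the three
  -- hypotheses.
  noThree-stack : ∀ {n} {A B : Vec F n → Set} →
    AffinelyIndependent A → NoDirection A B → NoThree B → NoThree (Stack A B)
  noThree-stack {A = A} {B} indep noDir noThree = go
    where
      two : ∀ {a b c X Y Z} → A X → A Y → B Z → a ≢ 0# → c ≢ 0# →
        comb₃ a b c (1# ∷ X) (1# ∷ Y) (0# ∷ Z) ≢ 0ᵛ
      two {a} {b} {c} {X} {Y} {Z} aX aY bZ a≢0 c≢0 eq with ∷-injective eq
      ... | p₀ , p₁ with pair-sum {a = a} {b} {c} X Y Z a≢0 c≢0
            (trans (solve 3 (λ a b c → a :+ b := a :* con true :+ b :* con true :+ c :* con false) refl a b c) p₀) p₁
      ... | d , d≢0 , p = noDir aX aY bZ d≢0 p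

      one : ∀ {n a b c} {X Y Z : Vec F n} → a ≢ 0# → comb₃ a b c (1# ∷ X) (0# ∷ Y) (0# ∷ Z) ≢ 0ᵛ
      one {_} {a} {b} {c} a≢0 eq = a≢0
        (trans (solve 3 (λ a b c → a := a :* con true :+ b :* con false :+ c :* con false) refl a b c)
          (proj₁ (∷-injective eq)))

      rot : ∀ {n a b c} {X Y Z : Vec F n} → comb₃ a b c X Y Z ≡ 0ᵛ → comb₃ b c a Y Z X ≡ 0ᵛ
      rot {a = a} {b} {c} {X} {Y} {Z} = rotate (a · X) (b · Y) (c · Z)

      go : NoThree (Stack A B)
      go (inj₁ (X , aX , refl)) (inj₁ (Y , aY , refl)) (inj₁ (Z , aZ , refl)) X≢Y Y≢Z X≢Z {a} {b} {c} a≢0 b≢0 c≢0 eq =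
        indep aX aY aZ (X≢Y ∘ cong _) (Y≢Z ∘ cong _) (X≢Z ∘ cong _) a≢0 b≢0 c≢0
          (trans (solve 3 (λ a b c → a :+ b :+ c := a :* con true :+ b :* con true :+ c :* con true) refl a b c)
            (proj₁ (∷-injective eq)))
          (proj₂ (∷-injective eq))
      go (inj₁ (X , aX , refl)) (inj₁ (Y , aY , refl)) (inj₂ (Z , bZ , refl)) _ _ _ a≢0 b≢0 c≢0 eq =
        two aX aY bZ a≢0 c≢0 eq
      go {X'} {Y'} {Z'} (inj₁ (X , aX , refl)) (inj₂ (Y , bY , refl)) (inj₁ (Z , aZ , refl)) _ _ _ {a} {b} {c} a≢0 b≢0 c≢0 eq =
        two aZ aX bY c≢0 b≢0 (rot {a = b} {c} {a} {Y'} {Z'} {X'} (rot {a = a} {b} {c} {X'} {Y'} {Z'} eq))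
      go {X'} {Y'} {Z'} (inj₂ (X , bX , refl)) (inj₁ (Y , aY , refl)) (inj₁ (Z , aZ , refl)) _ _ _ {a} {b} {c} a≢0 b≢0 c≢0 eq =
        two aY aZ bX b≢0 a≢0 (rot {a = a} {b} {c} {X'} {Y'} {Z'} eq)
      go (inj₁ (X , aX , refl)) (inj₂ (Y , bY , refl)) (inj₂ (Z , bZ , refl)) _ _ _ a≢0 b≢0 c≢0 eq =
        one {X = X} {Y} {Z} a≢0 eq
      go {X'} {Y'} {Z'} (inj₂ (X , bX , refl)) (inj₁ (Y , aY , refl)) (inj₂ (Z , bZ , refl)) _ _ _ {a} {b} {c} a≢0 b≢0 c≢0 eq =
        one {X = Y} {Z} {X} b≢0 (rot {a = a} {b} {c} {X'} {Y'} {Z'} eq)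
      go {X'} {Y'} {Z'} (inj₂ (X , bX , refl)) (inj₂ (Y , bY , refl)) (inj₁ (Z , aZ , refl)) _ _ _ {a} {b} {c} a≢0 b≢0 c≢0 eq =
        one {X = Z} {X} {Y} c≢0 (rot {a = b} {c} {a} {Y'} {Z'} {X'} (rot {a = a} {b} {c} {X'} {Y'} {Z'} eq))
      go (inj₂ (X , bX , refl)) (inj₂ (Y , bY , refl)) (inj₂ (Z , bZ , refl)) X≢Y Y≢Z X≢Z a≢0 b≢0 c≢0 eq =
        noThree bX bY bZ (X≢Y ∘ cong _) (Y≢Z ∘ cong _) (X≢Z ∘ cong _) a≢0 b≢0 c≢0 (proj₂ (∷-injective eq))

  -- The points of 𝒫 and decompositions of tails

  sqVec-injective : ∀ {j} {α β : Vec F j} → sqVec α ≡ sqVec β → α ≡ β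
  sqVec-injective {α = []}    {[]}    p = refl
  sqVec-injective {α = _ ∷ _} {_ ∷ _} p with ∷-injective p
  ... | p₀ , p₁ = cong₂ _∷_ p₀ (sqVec-injective (proj₂ (∷-injective p₁)))

  sqVec-0 : ∀ j → sqVec {j} 0ᵛ ≡ 0ᵛ
  sqVec-0 zero    = refl
  sqVec-0 (suc j) = cong₂ _∷_ refl (cong₂ _∷_ (x*0≡0 0#) (sqVec-0 j))

  a·sqVec0≡0 : ∀ j a → a · sqVec {j} 0ᵛ ≡ 0ᵛ
  a·sqVec0≡0 j a = trans (cong (a ·_) (sqVec-0 j)) (a·0≡0 _ a)

  sqVec≡0⇒≡0 : ∀ {j} {α : Vec F j} → sqVec α ≡ 0ᵛ → α ≡ 0ᵛ
  sqVec≡0⇒≡0 {j} p = sqVec-injective (trans p (sym (sqVec-0 j)))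

  sqVec-⊕ : ∀ {j} (α β : Vec F j) → sqVec α ⊕ sqVec β ≡ sqVec (α ⊕ β)
  sqVec-⊕ []      []      = refl
  sqVec-⊕ (a ∷ α) (b ∷ β) = cong₂ _∷_ refl (cong₂ _∷_
    (solve 2 (λ a b → a :* a :+ b :* b := (a :+ b) :* (a :+ b)) refl a b) (sqVec-⊕ α β))

  sqVec-independent : ∀ {j a b c} (α β γ : Vec F j) → a ≢ 0# → b ≢ 0# → c ≢ 0# → a +ᶠ b +ᶠ c ≡ 0# →
    comb₃ a b c (sqVec α) (sqVec β) (sqVec γ) ≡ 0ᵛ → α ≡ β × β ≡ γ
  sqVec-independent []      []      []      a≢0 b≢0 c≢0 p₀ p = refl , refl
  sqVec-independent (x ∷ α) (y ∷ β) (z ∷ γ) a≢0 b≢0 c≢0 p₀ p with ∷-injective p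
  ... | p₁ , p′ with ∷-injective p′
  ... | p₂ , p″ with conic-independent a≢0 b≢0 c≢0 p₀ p₁ p₂ | sqVec-independent α β γ a≢0 b≢0 c≢0 p₀ p″
  ... | refl , refl | refl , refl = refl , refl

  -- t = (z₁,w₁,…,z_j,w_j) satisfies zᵢ² = c wᵢ; equivalently, if c ≠ 0, t is c times a point of 𝒫ʲ.
  Parabolic : ∀ j → F → Vec F (e j) → Set
  Parabolic zero    c []          = ⊤
  Parabolic (suc j) c (z ∷ w ∷ t) = z *ᶠ z ≡ c *ᶠ w × Parabolic j c t

  parabolic? : ∀ j c t → Dec (Parabolic j c t)
  parabolic? zero    c []          = yes tt
  parabolic? (suc j) c (z ∷ w ∷ t) = (z *ᶠ z) ≟ (c *ᶠ w) ×-dec parabolic? j c t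

  parabolic-0 : ∀ j c → Parabolic j c 0ᵛ
  parabolic-0 zero    c = tt
  parabolic-0 (suc j) c = trans (x*0≡0 0#) (sym (x*0≡0 c)) , parabolic-0 j c

  parabolic-· : ∀ {j} c (α : Vec F j) → Parabolic j c (c · sqVec α)
  parabolic-· c []      = tt
  parabolic-· c (a ∷ α) =
    solve 2 (λ c a → c :* a :* (c :* a) := c :* (c :* (a :* a))) refl c a , parabolic-· c α

  parabolic-1 : ∀ {j} (α : Vec F j) → Parabolic j 1# (sqVec α)
  parabolic-1 α = subst (Parabolic _ 1#) (1·X≡X (sqVec α)) (parabolic-· 1# α)

  parabolic-1⁻ : ∀ j t → Parabolic j 1# t → ∃[ α ] t ≡ sqVec {j} α
  parabolic-1⁻ zero    []          _       = [] , refl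
  parabolic-1⁻ (suc j) (z ∷ w ∷ t) (p , ps) with parabolic-1⁻ j t ps
  ... | α , refl = z ∷ α , cong (z ∷_) (cong (_∷ _)
    (sym (trans p (solve 1 (λ w → con true :* w := w) refl w))))

  parabolic-unique : ∀ j {c d} t → c ≢ d → Parabolic j c t → Parabolic j d t → t ≡ 0ᵛ
  parabolic-unique zero    []          c≢d _ _ = refl
  parabolic-unique (suc j) {c} {d} (z ∷ w ∷ t) c≢d (p , ps) (r , rs) =
    cong₂ _∷_ z≡0 (cong₂ _∷_ w≡0 (parabolic-unique j t c≢d ps rs))
    where
      w≡0 : w ≡ 0#
      w≡0 = xy≡0⇒y≡0 (λ c+d → c≢d (x+y≡0⇒x≡y c+d))
        (trans (solve 3 (λ c d w → (c :+ d) :* w := c :* w :+ d :* w) refl c d w)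
          (x≡y⇒x+y≡0 (trans (sym p) r)))
      z≡0 : z ≡ 0#
      z≡0 = xx≡0⇒x≡0 (trans p (trans (cong (c *ᶠ_) w≡0) (x*0≡0 c)))

  -- The common vector is `Parabolic` for 1, as `sqVec u`, and for `c`, as `c · sqVec α`; being
  -- nonzero it admits only one parameter.
  sqVec-scale : ∀ {j c} (u α : Vec F j) → c ≢ 0# → NonZeroVec α → sqVec u ≡ c · sqVec α → c ≡ 1#
  sqVec-scale {j} {c} u α c≢0 α≢0 p with c ≟ 1#
  ... | yes c≡1 = c≡1
  ... | no  c≢1 = ⊥-elim (α≢0 (sqVec≡0⇒≡0 (a·X≡0⇒X≡0 (sqVec α) c≢0
    (parabolic-unique j _ c≢1 (parabolic-· c α) (subst (Parabolic j 1#) p (parabolic-1 u))))))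

  split : ∀ j {a b} → a ≢ 0# → b ≢ 0# → a +ᶠ b ≢ 0# → ∀ t →
    ∃[ α ] ∃[ β ] t ≡ (a · sqVec {j} α) ⊕ (b · sqVec {j} β)
  split zero    a≢0 b≢0 a+b≢0 [] = [] , [] , refl
  split (suc j) a≢0 b≢0 a+b≢0 (z ∷ w ∷ t) =
    let x , y , z≡ , w≡ = split-coordinate a≢0 b≢0 a+b≢0 z w
        α , β , t≡      = split j a≢0 b≢0 a+b≢0 t
    in x ∷ α , y ∷ β , cong₂ _∷_ z≡ (cong₂ _∷_ w≡ t≡)

  record Split (j : ℕ) (a b : F) (t : Vec F (e j)) : Set where
    constructor mkSplit
    field
      α β : Vec F j
      t≡  : t ≡ (a · sqVec α) ⊕ (b · sqVec β)
      α≢0 : NonZeroVec α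
      β≢0 : NonZeroVec β

  split-nonzero : ∀ j {a b} → a ≢ 0# → b ≢ 0# → a +ᶠ b ≢ 0# → ∀ t →
    ¬ Parabolic j a t → ¬ Parabolic j b t → Split j a b t
  split-nonzero j {a} {b} a≢0 b≢0 a+b≢0 t ¬pa ¬pb with split j a≢0 b≢0 a+b≢0 t
  ... | α , β , refl = mkSplit α β refl
    (λ { refl → ¬pb (subst (Parabolic j b) (sym (trans (cong (_⊕ (b · sqVec β))
      (a·sqVec0≡0 j a)) (0⊕X≡X _))) (parabolic-· b β)) })
    (λ { refl → ¬pa (subst (Parabolic j a) (sym (trans (cong ((a · sqVec α) ⊕_)
      (a·sqVec0≡0 j b)) (X⊕0≡X _))) (parabolic-· a α)) })

  -- With `α = β` the sum collapses to `(a + b) · sqVec α`. It is used with `a + b = 1`, where this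
  -- means that the tail already lies in 𝒫.
  split-distinct : ∀ {j a b} {α β : Vec F j} →
    ¬ Parabolic j (a +ᶠ b) ((a · sqVec α) ⊕ (b · sqVec β)) → α ≢ β
  split-distinct {j} {a} {b} {α} ¬p refl =
    ¬p (subst (Parabolic j (a +ᶠ b)) (+-distrib-· a b (sqVec α)) (parabolic-· (a +ᶠ b) α))

  λ+[1+λ]≡1 : ∀ l → l +ᶠ (1# +ᶠ l) ≡ 1#
  λ+[1+λ]≡1 = solve 1 (λ l → l :+ (con true :+ l) := con true) refl

  -- At most one c has Parabolic j c t when t ≠ 0, so of two disjoint pairs {l, 1 + l} one works.
  split-affine : 4 < q → ∀ j t → ¬ Parabolic j 1# t →
    ∃[ l ] Σ (Split j l (1# +ᶠ l) t) λ sp → Split.α sp ≢ Split.β sp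
  split-affine 4<q j t ¬p1 = choose
    where
      t≢0 : t ≢ 0ᵛ
      t≢0 refl = ¬p1 (parabolic-0 j 1#)

      good : ∀ l → l ≢ 0# → l ≢ 1# → ¬ Parabolic j l t → ¬ Parabolic j (1# +ᶠ l) t →
        ∃[ l ] Σ (Split j l (1# +ᶠ l) t) λ sp → Split.α sp ≢ Split.β sp
      good l l≢0 l≢1 ¬pl ¬p1+l
        with split-nonzero j l≢0 (x≢1⇒1+x≢0 l≢1) (λ p → 1≢0 (trans (sym (λ+[1+λ]≡1 l)) p)) t ¬pl ¬p1+l
      ... | sp@(mkSplit α β refl _ _) =
        l , sp , split-distinct (subst (λ c → ¬ Parabolic j c t) (sym (λ+[1+λ]≡1 l)) ¬p1)

      second : ∀ c → Parabolic j c t → ∃[ l ] Σ (Split j l (1# +ᶠ l) t) λ sp → Split.α sp ≢ Split.β sp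
      -- Excluding both `c` and `1 + c` keeps `l` as well as `1 + l` away from the parameter `c`.
      -- These four excluded values are the origin of the bound `4 < q`.
      second c pc with avoid (0# ∷ 1# ∷ c ∷ (1# +ᶠ c) ∷ []) 4<q
      ... | l , l≢0 ∷ l≢1 ∷ l≢c ∷ l≢1+c ∷ [] = good l l≢0 l≢1
        (λ pl → t≢0 (parabolic-unique j t l≢c pl pc))
        (λ pl → t≢0 (parabolic-unique j t
          (λ p → l≢1+c (trans (solve 1 (λ l → l := con true :+ (con true :+ l)) refl l) (cong (1# +ᶠ_) p))) pl pc))

      choose : ∃[ l ] Σ (Split j l (1# +ᶠ l) t) λ sp → Split.α sp ≢ Split.β sp
      choose with avoid (0# ∷ 1# ∷ []) (ℕ.≤-trans (s≤s (s≤s (s≤s z≤n))) 4<q)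
      ... | l , l≢0 ∷ l≢1 ∷ [] with parabolic? j l t | parabolic? j (1# +ᶠ l) t
      ... | yes pl | _       = second l pl
      ... | no _   | yes p1+l = second (1# +ᶠ l) p1+l
      ... | no ¬pl | no ¬p1+l = good l l≢0 l≢1 ¬pl ¬p1+l

  -- Counting vectors and layers

  field-size : HasSize (λ (_ : F) → ⊤) q
  field-size = elements , elements-unique , (λ a → mk⇔ _ (λ _ → elements-complete a)) , elements-count

  vectors-size : ∀ j → HasSize (λ (_ : Vec F j) → ⊤) (q ^ j)
  vectors-size zero    = hasSize-⇔ _ (λ { {[]} _ → refl }) (hasSize-singleton [])
  vectors-size (suc j) = hasSize-⇔ _ (λ { {x ∷ v} _ → (x , v) , _ , refl })
    (hasSize-image (λ (x , v) → x ∷ v) (λ p → let p₀ , p₁ = ∷-injective p in cong₂ _,_ p₀ p₁)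
      (hasSize-× field-size (vectors-size j)))

  nonZero-size : ∀ j → ∃[ r ] q ^ j ≡ suc r × HasSize (NonZeroVec {j}) r
  nonZero-size j = let r , eq , size = hasSize-remove {x = 0ᵛ} tt (vectors-size j) in
    r , eq , hasSize-⇔ proj₂ (tt ,_) size

  stack-size : ∀ {n a b} {A B : Vec F n → Set} → HasSize A a → HasSize B b → HasSize (Stack A B) (a + b)
  stack-size sA sB = hasSize-⊎
    (λ { (_ , _ , refl) (_ , _ , p) → 1≢0 (proj₁ (∷-injective p)) })
    (hasSize-image (1# ∷_) (proj₂ ∘ ∷-injective) sA) (hasSize-image (0# ∷_) (proj₂ ∘ ∷-injective) sB)

  headed-size : ∀ {n a x y} {A : Vec F n → Set} → x ≢ y → HasSize A a →
    HasSize (λ v → ∃[ h ] ∃[ u ] (h ≡ x ⊎ h ≡ y) × A u × v ≡ h ∷ u) (a + a)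
  headed-size {x = x} {y} x≢y sA = hasSize-⇔
    (λ { (inj₁ (u , au , v≡)) → x , u , inj₁ refl , au , v≡ ; (inj₂ (u , au , v≡)) → y , u , inj₂ refl , au , v≡ })
    (λ { (_ , u , inj₁ refl , au , v≡) → inj₁ (u , au , v≡) ; (_ , u , inj₂ refl , au , v≡) → inj₂ (u , au , v≡) })
    (hasSize-⊎ (λ { (_ , _ , refl) (_ , _ , p) → x≢y (proj₁ (∷-injective p)) })
      (hasSize-image (x ∷_) (proj₂ ∘ ∷-injective) sA) (hasSize-image (y ∷_) (proj₂ ∘ ∷-injective) sA))

-- The recursive caps in odd dimension: no three collinear points

module OddCap {q : ℕ} (𝔽 : FiniteField2 q) where
  open Geometry 𝔽
  open Field 𝔽
  open Vectors 𝔽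

  two-values : ∀ {m m′ x y z : F} → x ≡ m ⊎ x ≡ m′ → y ≡ m ⊎ y ≡ m′ → z ≡ m ⊎ z ≡ m′ →
    x ≢ y → y ≢ z → x ≢ z → ⊥
  two-values (inj₁ refl) (inj₁ refl) _           x≢y _   _   = x≢y refl
  two-values (inj₁ refl) (inj₂ refl) (inj₁ refl) _   _   x≢z = x≢z refl
  two-values (inj₁ refl) (inj₂ refl) (inj₂ refl) _   y≢z _   = y≢z refl
  two-values (inj₂ refl) (inj₁ refl) (inj₁ refl) _   y≢z _   = y≢z refl
  two-values (inj₂ refl) (inj₁ refl) (inj₂ refl) _   _   x≢z = x≢z refl
  two-values (inj₂ refl) (inj₂ refl) _           x≢y _   _   = x≢y refl

  -- The directions `(1,0)` and `(0,1)` are the nucleus and the infinite point of the conic of all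
  -- `(1,a,a²)`. Together they form a hyperoval, so no chord of the affine conic has either
  -- direction.
  square-pair-10 : ∀ {x c} → x ≡ c *ᶠ 1# → x *ᶠ x ≡ c *ᶠ 0# → c ≡ 0#
  square-pair-10 {x} {c} p r = trans (trans (sym (x*1≡x c)) (sym p)) (xx≡0⇒x≡0 (trans r (x*0≡0 c)))

  square-pair-01 : ∀ {x c} → x ≡ c *ᶠ 0# → x *ᶠ x ≡ c *ᶠ 1# → c ≡ 0#
  square-pair-01 {x} {c} p r =
    trans (sym (x*1≡x c)) (trans (sym r) (trans (cong (_*ᶠ x) (trans p (x*0≡0 c))) (0*x≡0 x)))

  module Slopes (m1 m2 : F) (m1≢0 : m1 ≢ 0#) (m2≢0 : m2 ≢ 0#) (m1≢m2 : m1 ≢ m2)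
           (μ³≢1 : (m1 +ᶠ m2) *ᶠ ((m1 +ᶠ m2) *ᶠ (m1 +ᶠ m2)) ≢ 1#)
           (m1≢1 : m1 ≢ 1#) (m2≢1 : m2 ≢ 1#) where

    private
      μ : F
      μ = m1 +ᶠ m2

      μ≢1 : μ ≢ 1#
      μ≢1 p = μ³≢1 (trans (cong (λ x → x *ᶠ (x *ᶠ x)) p) (trans (cong (1# *ᶠ_) (x*1≡x 1#)) (x*1≡x 1#)))

      μ≢0 : μ ≢ 0#
      μ≢0 = m1≢m2 ∘ x+y≡0⇒x≡y

    -- The first two coordinates decide. For a slope point the tails force `c = 1`, and then `x = 1`
    -- and `x² = m` contradict `m ≠ 1`; points starting with `(1,0)` or `(0,1)` are excluded by
    -- `square-pair-10` and `square-pair-01`; points starting with `(0,0)` recurse.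
    odd-not-parabolic : ∀ i {b c} (u : Vec F (suc i)) → c ≢ 0# → Kodd m1 m2 i b → sqVec u ≢ c · b
    odd-not-parabolic zero (x ∷ []) c≢0 (inj₁ refl) p =
      c≢0 (square-pair-10 (proj₁ (∷-injective p)) (proj₁ (∷-injective (proj₂ (∷-injective p)))))
    odd-not-parabolic zero (x ∷ []) c≢0 (inj₂ refl) p =
      c≢0 (square-pair-01 (proj₁ (∷-injective p)) (proj₁ (∷-injective (proj₂ (∷-injective p)))))
    odd-not-parabolic (suc i) {b} {c} (x ∷ u) c≢0 k p = go k
      where
        slope : ∀ {m} (a : Vec F (suc i)) → m ≢ 1# → NonZeroVec a → sqVec (x ∷ u) ≢ c · (1# ∷ m ∷ sqVec a)
        slope {m} a m≢1 a≢0 p with ∷-injective p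
        ... | p₀ , p′ with ∷-injective p′
        ... | p₁ , p″ with sqVec-scale u a c≢0 a≢0 p″
        ... | refl = m≢1 (by₂ (x +ᶠ 1#) 1# (x≡y⇒x+y≡0 p₀) (x≡y⇒x+y≡0 p₁)
          (solve 2 (λ x m → m :+ con true
            := (x :+ con true :* con true) :* (x :+ con true) :+ (x :* x :+ con true :* m) :* con true) refl x m))
        go : Kodd m1 m2 (suc i) b → ⊥
        go (inj₁ (a , a≢0 , inj₁ refl)) = slope a m1≢1 a≢0 p
        go (inj₁ (a , a≢0 , inj₂ refl)) = slope a m2≢1 a≢0 p
        go (inj₂ (inj₁ (a , a≢0 , refl))) =
          c≢0 (square-pair-01 (proj₁ (∷-injective p)) (proj₁ (∷-injective (proj₂ (∷-injective p)))))
        go (inj₂ (inj₂ (inj₁ (b′ , k′ , refl)))) =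
          odd-not-parabolic i u c≢0 k′ (proj₂ (∷-injective (proj₂ (∷-injective p))))
        go (inj₂ (inj₂ (inj₂ refl))) =
          c≢0 (square-pair-10 (proj₁ (∷-injective p)) (proj₁ (∷-injective (proj₂ (∷-injective p)))))

    NonZeroConic : ∀ j → Vec F (e j) → Set
    NonZeroConic j x = ∃[ α ] NonZeroVec α × x ≡ sqVec {j} α

    -- The alternative `h = 0`, `α = 0` is the isolated point `(1,0,…,0)`, which shares its layer
    -- with the points of slope `m1` and `m2`.
    SlopePart : ∀ j → Vec F (suc (e j)) → Set
    SlopePart j x = ∃[ h ] ∃[ α ] x ≡ h ∷ sqVec {j} α
      × (NonZeroVec α × (h ≡ m1 ⊎ h ≡ m2) ⊎ h ≡ 0# × α ≡ 0ᵛ)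

    odd⇒stack : ∀ i {v} → Kodd m1 m2 (suc i) v →
      Stack (SlopePart (suc i)) (Stack (NonZeroConic (suc i)) (Kodd m1 m2 i)) v
    odd⇒stack i (inj₁ (a , a≢0 , inj₁ refl))          = inj₁ (_ , (_ , _ , refl , inj₁ (a≢0 , inj₁ refl)) , refl)
    odd⇒stack i (inj₁ (a , a≢0 , inj₂ refl))          = inj₁ (_ , (_ , _ , refl , inj₁ (a≢0 , inj₂ refl)) , refl)
    odd⇒stack i (inj₂ (inj₁ (a , a≢0 , refl)))        = inj₂ (_ , inj₁ (_ , (a , a≢0 , refl) , refl) , refl)
    odd⇒stack i (inj₂ (inj₂ (inj₁ (b , k , refl))))   = inj₂ (_ , inj₂ (_ , k , refl) , refl)
    odd⇒stack i (inj₂ (inj₂ (inj₂ refl)))             =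
      inj₁ (_ , (0# , 0ᵛ , cong (0# ∷_) (sym (sqVec-0 (suc i))) , inj₂ (refl , refl)) , refl)

    conic-affinelyIndependent : ∀ j → AffinelyIndependent (NonZeroConic j)
    conic-affinelyIndependent j (α , _ , refl) (β , _ , refl) (γ , _ , refl) X≢Y _ _ a≢0 b≢0 c≢0 sum eq =
      X≢Y (cong sqVec (proj₁ (sqVec-independent α β γ a≢0 b≢0 c≢0 sum eq)))

    -- Once the tails agree, the three heads would be distinct, but a nonzero tail allows only `m1`
    -- and `m2`, and a zero tail only 0.
    slope-affinelyIndependent : ∀ j → AffinelyIndependent (SlopePart j)
    slope-affinelyIndependent j (h , α , refl , hα) (h′ , β , refl , hβ) (h″ , γ , refl , hγ) X≢Y Y≢Z X≢Z a≢0 b≢0 c≢0 sum eq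
      with sqVec-independent α β γ a≢0 b≢0 c≢0 sum (proj₂ (∷-injective eq))
    ... | refl , refl = go hα hβ hγ
      where
        go : NonZeroVec α × (h ≡ m1 ⊎ h ≡ m2) ⊎ h ≡ 0# × α ≡ 0ᵛ →
             NonZeroVec α × (h′ ≡ m1 ⊎ h′ ≡ m2) ⊎ h′ ≡ 0# × α ≡ 0ᵛ →
             NonZeroVec α × (h″ ≡ m1 ⊎ h″ ≡ m2) ⊎ h″ ≡ 0# × α ≡ 0ᵛ → ⊥
        go (inj₁ (_ , p)) (inj₁ (_ , r)) (inj₁ (_ , s)) =
          two-values p r s (X≢Y ∘ cong (_∷ _)) (Y≢Z ∘ cong (_∷ _)) (X≢Z ∘ cong (_∷ _))
        go (inj₂ (refl , _)) (inj₂ (refl , _)) _ = X≢Y refl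
        go (inj₁ (α≢0 , _)) (inj₂ (_ , α≡0)) _ = α≢0 α≡0
        go (inj₂ (_ , α≡0)) (inj₁ (α≢0 , _)) _ = α≢0 α≡0
        go (inj₁ (α≢0 , _)) (inj₁ _) (inj₂ (_ , α≡0)) = α≢0 α≡0

    conic-noDirection : ∀ i → NoDirection (NonZeroConic (suc i)) (Kodd m1 m2 i)
    conic-noDirection i (α , _ , refl) (β , _ , refl) k c≢0 p =
      odd-not-parabolic i (α ⊕ β) c≢0 k (trans (sym (sqVec-⊕ α β)) p)

    private
      x+x≢1 : ∀ {x} → x +ᶠ x ≢ 1#
      x+x≢1 p = 0≢1 (trans (sym (x≡y⇒x+y≡0 refl)) p)
      x+0≢1 : ∀ {x} → x ≢ 1# → x +ᶠ 0# ≢ 1#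
      x+0≢1 {x} x≢1 p = x≢1 (trans (solve 1 (λ x → x := x :+ con false) refl x) p)
      swap : ∀ {x y} → x +ᶠ y ≢ 1# → y +ᶠ x ≢ 1#
      swap {x} {y} ne p = ne (trans (solve 2 (λ x y → x :+ y := y :+ x) refl x y) p)

    slope-difference≢1 : ∀ {h h′ : F} →
      (h ≡ m1 ⊎ h ≡ m2) ⊎ h ≡ 0# → (h′ ≡ m1 ⊎ h′ ≡ m2) ⊎ h′ ≡ 0# → h +ᶠ h′ ≢ 1#
    slope-difference≢1 (inj₁ (inj₁ refl)) (inj₁ (inj₁ refl)) = x+x≢1
    slope-difference≢1 (inj₁ (inj₁ refl)) (inj₁ (inj₂ refl)) = μ≢1
    slope-difference≢1 (inj₁ (inj₂ refl)) (inj₁ (inj₁ refl)) = swap μ≢1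
    slope-difference≢1 (inj₁ (inj₂ refl)) (inj₁ (inj₂ refl)) = x+x≢1
    slope-difference≢1 (inj₁ (inj₁ refl)) (inj₂ refl)        = x+0≢1 m1≢1
    slope-difference≢1 (inj₁ (inj₂ refl)) (inj₂ refl)        = x+0≢1 m2≢1
    slope-difference≢1 (inj₂ refl)        (inj₁ (inj₁ refl)) = swap (x+0≢1 m1≢1)
    slope-difference≢1 (inj₂ refl)        (inj₁ (inj₂ refl)) = swap (x+0≢1 m2≢1)
    slope-difference≢1 (inj₂ refl)        (inj₂ refl)        = x+x≢1

    -- Against a point starting with `(0,1)` the tails force `c = 1`, so the two heads would differ
    -- by 1; `slope-difference≢1` forbids this because none of `m1`, `m2` and `m1 + m2` equals 1.
    slope-noDirection : ∀ i →
      NoDirection (SlopePart (suc i)) (Stack (NonZeroConic (suc i)) (Kodd m1 m2 i))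
    slope-noDirection i (h , α , refl , hα) (h′ , β , refl , hβ) (inj₁ (_ , (γ , γ≢0 , refl) , refl)) {c} c≢0 p
      with sqVec-scale (α ⊕ β) γ c≢0 γ≢0 (trans (sym (sqVec-⊕ α β)) (proj₂ (∷-injective p)))
    ... | refl = slope-difference≢1 (value hα) (value hβ) (trans (proj₁ (∷-injective p)) (x*1≡x 1#))
      where
        value : ∀ {h} {α : Vec F (suc i)} → NonZeroVec α × (h ≡ m1 ⊎ h ≡ m2) ⊎ h ≡ 0# × α ≡ 0ᵛ →
          (h ≡ m1 ⊎ h ≡ m2) ⊎ h ≡ 0#
        value = [ inj₁ ∘ proj₂ , inj₂ ∘ proj₁ ]′
    slope-noDirection i (h , α , refl , _) (h′ , β , refl , _) (inj₂ (_ , k , refl)) c≢0 p =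
      odd-not-parabolic i (α ⊕ β) c≢0 k (trans (sym (sqVec-⊕ α β)) (proj₂ (∷-injective p)))

    odd-noThree : ∀ i → NoThree (Kodd m1 m2 i)
    odd-noThree zero pX pY pZ X≢Y Y≢Z X≢Z _ _ _ _ = go pX pY pZ X≢Y Y≢Z X≢Z
      where
        go : ∀ {X Y Z} → Kodd m1 m2 zero X → Kodd m1 m2 zero Y → Kodd m1 m2 zero Z → X ≢ Y → Y ≢ Z → X ≢ Z → ⊥
        go (inj₁ refl) (inj₁ refl) _           X≢Y _   _   = X≢Y refl
        go (inj₁ refl) (inj₂ refl) (inj₁ refl) _   _   X≢Z = X≢Z refl
        go (inj₁ refl) (inj₂ refl) (inj₂ refl) _   Y≢Z _   = Y≢Z refl
        go (inj₂ refl) (inj₁ refl) (inj₁ refl) _   Y≢Z _   = Y≢Z refl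
        go (inj₂ refl) (inj₁ refl) (inj₂ refl) _   _   X≢Z = X≢Z refl
        go (inj₂ refl) (inj₂ refl) _           X≢Y _   _   = X≢Y refl
    odd-noThree (suc i) = noThree-⊆ (odd⇒stack i)
      (noThree-stack (slope-affinelyIndependent (suc i)) (slope-noDirection i)
        (noThree-stack (conic-affinelyIndependent (suc i)) (conic-noDirection i) (odd-noThree i)))

    odd-isPointSet : ∀ i → IsPointSet (Kodd m1 m2 i)
    odd-isPointSet zero    _ (inj₁ refl) = inj₁ refl
    odd-isPointSet zero    _ (inj₂ refl) = inj₂ (refl , inj₁ refl)
    odd-isPointSet (suc i) _ (inj₁ (_ , _ , inj₁ refl))        = inj₁ refl
    odd-isPointSet (suc i) _ (inj₁ (_ , _ , inj₂ refl))        = inj₁ refl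
    odd-isPointSet (suc i) _ (inj₂ (inj₁ (_ , _ , refl)))      = inj₂ (refl , inj₁ refl)
    odd-isPointSet (suc i) _ (inj₂ (inj₂ (inj₁ (b , k , refl)))) = inj₂ (refl , inj₂ (refl , odd-isPointSet i b k))
    odd-isPointSet (suc i) _ (inj₂ (inj₂ (inj₂ refl)))         = inj₁ refl

    -- The recursive caps in odd dimension: coverage

    Kodd⁻ : ∀ i → Vec F (suc (suc (e i))) → Set
    Kodd⁻ i v = Kodd m1 m2 i v × v ≢ 1# ∷ 0ᵛ

    Slope : F → Set
    Slope m = m ≡ m1 ⊎ m ≡ m2

    slope≢0 : ∀ {m} → Slope m → m ≢ 0#
    slope≢0 (inj₁ refl) = m1≢0
    slope≢0 (inj₂ refl) = m2≢0

    slope∈Kodd⁻ : ∀ i {m} {α : Vec F (suc i)} → Slope m → NonZeroVec α → Kodd⁻ (suc i) (1# ∷ m ∷ sqVec α)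
    slope∈Kodd⁻ i {m} {α} m∈ α≢0 = member m∈ , λ p → slope≢0 m∈ (proj₁ (∷-injective (proj₂ (∷-injective p))))
      where
        member : ∀ {m} → Slope m → Kodd m1 m2 (suc i) (1# ∷ m ∷ sqVec α)
        member (inj₁ refl) = inj₁ (α , α≢0 , inj₁ refl)
        member (inj₂ refl) = inj₁ (α , α≢0 , inj₂ refl)

    vertical∈Kodd⁻ : ∀ i {α : Vec F (suc i)} → NonZeroVec α → Kodd⁻ (suc i) (0# ∷ 1# ∷ sqVec α)
    vertical∈Kodd⁻ i {α} α≢0 = inj₂ (inj₁ (α , α≢0 , refl)) , 0≢1 ∘ proj₁ ∘ ∷-injective

    lift∈Kodd⁻ : ∀ i {b} → Kodd m1 m2 i b → Kodd⁻ (suc i) (0# ∷ 0# ∷ b)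
    lift∈Kodd⁻ i k = inj₂ (inj₂ (inj₁ (_ , k , refl))) , 0≢1 ∘ proj₁ ∘ ∷-injective

    affine-head : ∀ l x → x ≡ l *ᶠ x +ᶠ (1# +ᶠ l) *ᶠ x
    affine-head = solve 2 (λ l x → x := l :* x :+ (con true :+ l) :* x) refl

    -- The equation for `l` is `l m1 + (1 + l) m2 = p` rearranged: the first two coordinates leave
    -- no freedom in the weights.
    slope-slope : ∀ i {p l t} → l *ᶠ μ ≡ p +ᶠ m2 → Split (suc i) l (1# +ᶠ l) t →
      Covered (Kodd⁻ (suc i)) (1# ∷ p ∷ t)
    slope-slope i {p} {l} l≡ (mkSplit α β t≡ α≢0 β≢0) =
      1# ∷ m1 ∷ sqVec α , 1# ∷ m2 ∷ sqVec β , slope∈Kodd⁻ i (inj₁ refl) α≢0 , slope∈Kodd⁻ i (inj₂ refl) β≢0 ,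
      (λ eq → m1≢m2 (proj₁ (∷-injective (proj₂ (∷-injective eq))))) , l , 1# +ᶠ l ,
      cong₂ _∷_ (affine-head l 1#) (cong₂ _∷_
        (by₁ 1# (x≡y⇒x+y≡0 l≡)
          (solve 4 (λ p l m1 m2 → p :+ (l :* m1 :+ (con true :+ l) :* m2)
            := (l :* (m1 :+ m2) :+ (p :+ m2)) :* con true) refl p l m1 m2)) t≡)

    slope-vertical : ∀ i {m p t} → Slope m → Split (suc i) 1# (p +ᶠ m) t →
      Covered (Kodd⁻ (suc i)) (1# ∷ p ∷ t)
    slope-vertical i {m} {p} m∈ (mkSplit α β t≡ α≢0 β≢0) =
      1# ∷ m ∷ sqVec α , 0# ∷ 1# ∷ sqVec β , slope∈Kodd⁻ i m∈ α≢0 , vertical∈Kodd⁻ i β≢0 ,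
      (λ eq → 1≢0 (proj₁ (∷-injective eq))) , 1# , p +ᶠ m ,
      cong₂ _∷_ (solve 2 (λ p m → con true := con true :* con true :+ (p :+ m) :* con false) refl p m)
        (cong₂ _∷_ (solve 2 (λ p m → p := con true :* m :+ (p :+ m) :* con true) refl p m) t≡)

    -- Where the hypothesis (m₁+m₂)³ ≠ 1 enters.
    slopes-exclude : ∀ {x y c} → x +ᶠ y ≡ μ → y ≢ 0# → c *ᶠ μ ≡ x ⊎ c *ᶠ μ ≡ y → x ≡ 1# → y ≢ c
    slopes-exclude {y = y} sum y≢0 (inj₁ r) refl refl = μ³≢1
      -- Here `y μ = 1` and `y = 1 + μ`, hence μ² + μ + 1 = 0; multiplying by μ + 1 gives μ³ = 1.
      (by₂ (μ +ᶠ 1#) (μ *ᶠ (μ +ᶠ 1#)) (x≡y⇒x+y≡0 r) (x≡y⇒x+y≡0 sum)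
        (solve 2 (λ μ y → μ :* (μ :* μ) :+ con true
          := (y :* μ :+ con true) :* (μ :+ con true) :+ (con true :+ y :+ μ) :* (μ :* (μ :+ con true)))
          refl μ y))
    slopes-exclude {y = y} sum y≢0 (inj₂ r) refl refl = μ≢1 (x+y≡0⇒x≡y (xy≡0⇒y≡0 y≢0
      (trans (solve 2 (λ μ y → y :* (μ :+ con true) := y :* μ :+ y) refl μ y) (x≡y⇒x+y≡0 r))))

    -- In `slope-vertical` the weights are 1 and `p + m`: they and their sum must be nonzero, and
    -- `p + m` must avoid the parameter `c` of the tail. If `m1` fails, then `p + m1` is 1 or `c`;
    -- `p + m2` differs from that value because `m1 ≠ m2`, and from the other one by
    -- `slopes-exclude`.
    good-slope : ∀ {p c} → p ≢ m1 → p ≢ m2 → c *ᶠ μ ≡ p +ᶠ m1 ⊎ c *ᶠ μ ≡ p +ᶠ m2 →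
      ∃[ m ] Slope m × p +ᶠ m ≢ 0# × p +ᶠ m ≢ 1# × p +ᶠ m ≢ c
    good-slope {p} {c} p≢m1 p≢m2 cμ = go ((p +ᶠ m1) ≟ 1#) ((p +ᶠ m1) ≟ c)
      where
        sum₁₂ : (p +ᶠ m1) +ᶠ (p +ᶠ m2) ≡ μ
        sum₁₂ = solve 3 (λ p m1 m2 → (p :+ m1) :+ (p :+ m2) := m1 :+ m2) refl p m1 m2
        sum₂₁ : (p +ᶠ m2) +ᶠ (p +ᶠ m1) ≡ μ
        sum₂₁ = solve 3 (λ p m1 m2 → (p :+ m2) :+ (p :+ m1) := m1 :+ m2) refl p m1 m2
        ≢₁ : p +ᶠ m1 ≢ 0#
        ≢₁ = p≢m1 ∘ x+y≡0⇒x≡y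
        ≢₂ : p +ᶠ m2 ≢ 0#
        ≢₂ = p≢m2 ∘ x+y≡0⇒x≡y
        distinct : ∀ {x} → p +ᶠ m1 ≡ x → p +ᶠ m2 ≢ x
        distinct r r′ = μ≢0 (trans (sym sum₁₂) (x≡y⇒x+y≡0 (trans r (sym r′))))
        go : Dec (p +ᶠ m1 ≡ 1#) → Dec (p +ᶠ m1 ≡ c) →
          ∃[ m ] Slope m × p +ᶠ m ≢ 0# × p +ᶠ m ≢ 1# × p +ᶠ m ≢ c
        go (no ≢1) (no ≢c) = m1 , inj₁ refl , ≢₁ , ≢1 , ≢c
        go (yes ≡1) _      = m2 , inj₂ refl , ≢₂ , distinct ≡1 , slopes-exclude sum₁₂ ≢₂ cμ ≡1
        go (no _) (yes ≡c) = m2 , inj₂ refl , ≢₂ ,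
          (λ r → slopes-exclude sum₂₁ ≢₁ ([ inj₂ , inj₁ ]′ cμ) r ≡c) , distinct ≡c

    -- A secant joining the two slopes works unless `l` or `1 + l` is the parameter of `t`. In that
    -- case the parameter is known, and differs from 1 as `p` is neither `m1` nor `m2`, so a secant
    -- through a point starting with `(0,1)` takes over.
    generic-coverage : ∀ i p t → p ≢ m1 → p ≢ m2 → t ≢ 0ᵛ → Covered (Kodd⁻ (suc i)) (1# ∷ p ∷ t)
    generic-coverage i p t p≢m1 p≢m2 t≢0 with inverse μ μ≢0
    ... | μ′ , μμ′ = go (parabolic? (suc i) l t) (parabolic? (suc i) (1# +ᶠ l) t)
      where
        l : F
        l = (p +ᶠ m2) *ᶠ μ′
        lμ : l *ᶠ μ ≡ p +ᶠ m2
        lμ = by₁ (p +ᶠ m2) (x≡y⇒x+y≡0 μμ′)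
          (solve 3 (λ r μ μ′ → r :* μ′ :* μ :+ r := (μ :* μ′ :+ con true) :* r) refl (p +ᶠ m2) μ μ′)
        1+lμ : (1# +ᶠ l) *ᶠ μ ≡ p +ᶠ m1
        1+lμ = by₁ 1# (x≡y⇒x+y≡0 lμ)
          (solve 4 (λ l p m1 m2 → (con true :+ l) :* (m1 :+ m2) :+ (p :+ m1)
            := (l :* (m1 :+ m2) :+ (p :+ m2)) :* con true) refl l p m1 m2)
        l≢0 : l ≢ 0#
        l≢0 = x*y≢0⇒x≢0 lμ (p≢m2 ∘ x+y≡0⇒x≡y)
        1+l≢0 : 1# +ᶠ l ≢ 0#
        1+l≢0 = x*y≢0⇒x≢0 1+lμ (p≢m1 ∘ x+y≡0⇒x≡y)

        vertical : ∀ {c} → Parabolic (suc i) c t → c ≢ 1# → c *ᶠ μ ≡ p +ᶠ m1 ⊎ c *ᶠ μ ≡ p +ᶠ m2 →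
          Covered (Kodd⁻ (suc i)) (1# ∷ p ∷ t)
        vertical {c} pc c≢1 cμ with good-slope p≢m1 p≢m2 cμ
        ... | m , m∈ , ≢0 , ≢1 , ≢c = slope-vertical i m∈
          (split-nonzero (suc i) 1≢0 ≢0 (x≢1⇒1+x≢0 ≢1) t
            (λ p1 → t≢0 (parabolic-unique (suc i) t c≢1 pc p1))
            (λ pm → t≢0 (parabolic-unique (suc i) t ≢c pm pc)))

        go : Dec (Parabolic (suc i) l t) → Dec (Parabolic (suc i) (1# +ᶠ l) t) →
          Covered (Kodd⁻ (suc i)) (1# ∷ p ∷ t)
        go (yes pl) _ = vertical pl (λ r → 1+l≢0 (trans (cong (1# +ᶠ_) r) char2)) (inj₂ lμ)
        go (no _) (yes p1+l) = vertical p1+l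
          (λ r → l≢0 (trans (solve 1 (λ l → l := con true :+ (con true :+ l)) refl l)
            (trans (cong (1# +ᶠ_) r) char2))) (inj₁ 1+lμ)
        go (no ¬pl) (no ¬p1+l) = slope-slope i lμ
          (split-nonzero (suc i) l≢0 1+l≢0 (λ r → 1≢0 (trans (sym (λ+[1+λ]≡1 l)) r)) t ¬pl ¬p1+l)

    -- The leftovers of the coverage by `Kodd`; in the final cap they lie on secants of the top
    -- layer.
    ConicMultiple : ∀ i → Vec F (suc (suc (e i))) → Set
    ConicMultiple i b = ∃[ c ] ∃[ u ] b ≡ c · sqVec {suc i} u

    -- `(1, p)` is `(p, p²)` divided by `p`.
    point-conicMultiple : ∀ i p → p ≢ 0# → ConicMultiple (suc i) (1# ∷ p ∷ 0ᵛ)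
    point-conicMultiple i p p≢0 with inverse p p≢0
    ... | p′ , pp′ = p′ , p ∷ 0ᵛ , cong₂ _∷_
      (by₁ 1# (x≡y⇒x+y≡0 pp′) (solve 2 (λ p p′ → con true :+ p′ :* p := (p :* p′ :+ con true) :* con true) refl p p′))
      (cong₂ _∷_
        (by₁ p (x≡y⇒x+y≡0 pp′) (solve 2 (λ p p′ → p :+ p′ :* (p :* p) := (p :* p′ :+ con true) :* p) refl p p′))
        (sym (a·sqVec0≡0 (suc i) p′)))

    lift-conicMultiple : ∀ i {b} → ConicMultiple i b → ConicMultiple (suc i) (0# ∷ 0# ∷ b)
    lift-conicMultiple i (c , u , b≡) = c , 0# ∷ u ,
      cong₂ _∷_ (sym (x*0≡0 c)) (cong₂ _∷_ (sym (trans (cong (c *ᶠ_) (x*0≡0 0#)) (x*0≡0 c))) b≡)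

    module _ (4<q : 4 < q) where

      -- For `t` outside 𝒫 the secant joins two points of the same slope, and weights with sum 1
      -- reproduce the head `m`. The tail `t = 0` gives a multiple of a conic point because `m ≠ 0`.
      slope-coverage : ∀ i {m} t → Slope m → Kodd⁻ (suc i) (1# ∷ m ∷ t)
        ⊎ Covered (Kodd⁻ (suc i)) (1# ∷ m ∷ t) ⊎ ConicMultiple (suc i) (1# ∷ m ∷ t)
      slope-coverage i {m} t m∈ with parabolic? (suc i) 1# t
      ... | no ¬p = let l , mkSplit α β t≡ α≢0 β≢0 , α≢β = split-affine 4<q (suc i) t ¬p in
        inj₂ (inj₁ (_ , _ , slope∈Kodd⁻ i m∈ α≢0 , slope∈Kodd⁻ i m∈ β≢0 ,
          (λ eq → α≢β (sqVec-injective (proj₂ (∷-injective (proj₂ (∷-injective eq)))))) , l , 1# +ᶠ l ,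
          cong₂ _∷_ (affine-head l 1#) (cong₂ _∷_ (affine-head l m) t≡)))
      ... | yes p with parabolic-1⁻ (suc i) t p
      ... | α , refl with α ≟ᵛ 0ᵛ
      ... | no α≢0   = inj₁ (slope∈Kodd⁻ i m∈ α≢0)
      ... | yes refl = inj₂ (inj₂ (subst (λ t → ConicMultiple (suc i) (1# ∷ m ∷ t)) (sym (sqVec-0 (suc i)))
        (point-conicMultiple i m (slope≢0 m∈))))

      vertical-coverage : ∀ i t →
        Kodd⁻ (suc i) (0# ∷ 1# ∷ t) ⊎ Covered (Kodd⁻ (suc i)) (0# ∷ 1# ∷ t)
      vertical-coverage i t with parabolic? (suc i) 1# t
      ... | no ¬p = let l , mkSplit α β t≡ α≢0 β≢0 , α≢β = split-affine 4<q (suc i) t ¬p in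
        inj₂ (_ , _ , vertical∈Kodd⁻ i α≢0 , vertical∈Kodd⁻ i β≢0 ,
          (λ eq → α≢β (sqVec-injective (proj₂ (∷-injective (proj₂ (∷-injective eq)))))) , l , 1# +ᶠ l ,
          cong₂ _∷_ (affine-head l 0#) (cong₂ _∷_ (affine-head l 1#) t≡))
      ... | yes p with parabolic-1⁻ (suc i) t p
      ... | α , refl with α ≟ᵛ 0ᵛ
      ... | no α≢0   = inj₁ (vertical∈Kodd⁻ i α≢0)
      ... | yes refl with inverse μ μ≢0
      -- Two points of different slope with the same nonzero tail add up to `(0, μ, 0, …, 0)`.
      ... | μ′ , μμ′ = inj₂ (1# ∷ m1 ∷ sqVec 1ᵛ , 1# ∷ m2 ∷ sqVec 1ᵛ ,
          slope∈Kodd⁻ i (inj₁ refl) 1ᵛ≢0 , slope∈Kodd⁻ i (inj₂ refl) 1ᵛ≢0 ,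
          (λ eq → m1≢m2 (proj₁ (∷-injective (proj₂ (∷-injective eq))))) , μ′ , μ′ ,
          cong₂ _∷_ (solve 1 (λ x → con false := x :* con true :+ x :* con true) refl μ′) (cong₂ _∷_
            (by₁ 1# (x≡y⇒x+y≡0 μμ′)
              (solve 3 (λ m1 m2 μ′ → con true :+ (μ′ :* m1 :+ μ′ :* m2)
                := ((m1 :+ m2) :* μ′ :+ con true) :* con true) refl m1 m2 μ′))
            (trans (sqVec-0 (suc i)) (sym (X⊕X≡0 (μ′ · sqVec 1ᵛ))))))
        where
          1ᵛ : Vec F (suc i)
          1ᵛ = replicate _ 1#
          1ᵛ≢0 : NonZeroVec 1ᵛ
          1ᵛ≢0 = 1≢0 ∘ proj₁ ∘ ∷-injective

      odd-coverage : ∀ i b → Normalized b → Kodd m1 m2 i b ⊎ Covered (Kodd m1 m2 i) b ⊎ ConicMultiple i b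

      -- The recursion passes through the full `Kodd`, where the fourth outcome `(1,0,…,0)` is
      -- itself a member; only the outermost level reports it.
      odd⁻-coverage : ∀ i b → Normalized b → Kodd⁻ (suc i) b
        ⊎ Covered (Kodd⁻ (suc i)) b ⊎ ConicMultiple (suc i) b ⊎ b ≡ 1# ∷ 0ᵛ

      odd-coverage zero (x ∷ y ∷ []) _ = inj₂ (inj₁ (_ , _ , inj₁ refl , inj₂ refl , 1≢0 ∘ proj₁ ∘ ∷-injective , x , y ,
        cong₂ _∷_ (solve 2 (λ x y → x := x :* con true :+ y :* con false) refl x y)
          (cong₂ _∷_ (solve 2 (λ x y → y := x :* con false :+ y :* con true) refl x y) refl)))
      odd-coverage (suc i) b nb with odd⁻-coverage i b nb
      ... | inj₁ (k , _) = inj₁ k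
      ... | inj₂ (inj₁ (X , Y , (kX , _) , (kY , _) , rest)) = inj₂ (inj₁ (X , Y , kX , kY , rest))
      ... | inj₂ (inj₂ (inj₁ m)) = inj₂ (inj₂ m)
      ... | inj₂ (inj₂ (inj₂ refl)) = inj₁ (inj₂ (inj₂ (inj₂ refl)))

      odd⁻-coverage i (_ ∷ p ∷ t) (inj₁ refl) with p ≟ m1 | p ≟ m2 | t ≟ᵛ 0ᵛ | p ≟ 0#
      ... | yes p≡m1 | _ | _ | _ = [ inj₁ , inj₂ ∘ [ inj₁ , inj₂ ∘ inj₁ ]′ ]′ (slope-coverage i t (inj₁ p≡m1))
      ... | no _ | yes p≡m2 | _ | _ = [ inj₁ , inj₂ ∘ [ inj₁ , inj₂ ∘ inj₁ ]′ ]′ (slope-coverage i t (inj₂ p≡m2))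
      ... | no p≢m1 | no p≢m2 | no t≢0 | _ = inj₂ (inj₁ (generic-coverage i p t p≢m1 p≢m2 t≢0))
      ... | no _ | no _ | yes refl | no p≢0 = inj₂ (inj₂ (inj₁ (point-conicMultiple i p p≢0)))
      ... | no _ | no _ | yes refl | yes refl = inj₂ (inj₂ (inj₂ refl))
      odd⁻-coverage i (_ ∷ _ ∷ t) (inj₂ (refl , inj₁ refl)) = [ inj₁ , inj₂ ∘ inj₁ ]′ (vertical-coverage i t)
      odd⁻-coverage i (_ ∷ _ ∷ b) (inj₂ (refl , inj₂ (refl , nb))) with odd-coverage i b nb
      ... | inj₁ k = inj₁ (lift∈Kodd⁻ i k)
      ... | inj₂ (inj₁ cov) = inj₂ (inj₁ (covered-map (λ X → 0# ∷ 0# ∷ X)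
        (λ eq → proj₂ (∷-injective (proj₂ (∷-injective eq)))) (lift∈Kodd⁻ i)
        (λ a b X Y → let h = solve 2 (λ a b → con false := a :* con false :+ b :* con false) refl a b in
          cong₂ _∷_ h (cong₂ _∷_ h refl)) cov))
      ... | inj₂ (inj₂ m) = inj₂ (inj₂ (inj₁ (lift-conicMultiple i m)))

    -- The recursive caps in odd dimension: size

    odd⁻⇒stack : ∀ i {v} → Kodd⁻ (suc i) v →
      Stack (λ x → ∃[ h ] ∃[ u ] Slope h × NonZeroConic (suc i) u × x ≡ h ∷ u)
        (Stack (NonZeroConic (suc i)) (Kodd m1 m2 i)) v
    odd⁻⇒stack i (inj₁ (a , a≢0 , inj₁ refl) , _)        = inj₁ (_ , (_ , _ , inj₁ refl , (a , a≢0 , refl) , refl) , refl)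
    odd⁻⇒stack i (inj₁ (a , a≢0 , inj₂ refl) , _)        = inj₁ (_ , (_ , _ , inj₂ refl , (a , a≢0 , refl) , refl) , refl)
    odd⁻⇒stack i (inj₂ (inj₁ (a , a≢0 , refl)) , _)      = inj₂ (_ , inj₁ (_ , (a , a≢0 , refl) , refl) , refl)
    odd⁻⇒stack i (inj₂ (inj₂ (inj₁ (b , k , refl))) , _) = inj₂ (_ , inj₂ (_ , k , refl) , refl)
    odd⁻⇒stack i (inj₂ (inj₂ (inj₂ refl)) , v≢)          = ⊥-elim (v≢ refl)

    stack⇒odd⁻ : ∀ i {v} →
      Stack (λ x → ∃[ h ] ∃[ u ] Slope h × NonZeroConic (suc i) u × x ≡ h ∷ u)
        (Stack (NonZeroConic (suc i)) (Kodd m1 m2 i)) v → Kodd⁻ (suc i) v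
    stack⇒odd⁻ i (inj₁ (_ , (_ , _ , h∈ , (_ , a≢0 , refl) , refl) , refl)) = slope∈Kodd⁻ i h∈ a≢0
    stack⇒odd⁻ i (inj₂ (_ , inj₁ (_ , (_ , a≢0 , refl) , refl) , refl))     = vertical∈Kodd⁻ i a≢0
    stack⇒odd⁻ i (inj₂ (_ , inj₂ (_ , k , refl) , refl))                    = lift∈Kodd⁻ i k

    odd-size : ∀ i → ∃[ n ] HasSize (Kodd m1 m2 i) n × n + 2 * i ≡ 3 * sumPow q i + 2

    odd⁻-size : ∀ i → ∃[ n ] HasSize (Kodd⁻ (suc i)) n × suc n + 2 * suc i ≡ 3 * sumPow q (suc i) + 2
    odd⁻-size i =
      let r , q^≡ , nz = nonZero-size (suc i)
          n , k , n≡   = odd-size i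
          conic        = hasSize-image sqVec sqVec-injective nz
      in r + r + (r + n) ,
         hasSize-⇔ (stack⇒odd⁻ i) (odd⁻⇒stack i) (stack-size (headed-size m1≢m2 conic) (stack-size conic k)) ,
         odd-count r n i (sumPow q i) q^≡ n≡

    odd-size zero    = 2 , hasSize-⊎ (λ { refl p → 1≢0 (proj₁ (∷-injective p)) })
      (hasSize-singleton _) (hasSize-singleton _) , refl
    odd-size (suc i) = let n , k , n≡ = odd⁻-size i in
      suc n ,
      hasSize-⇔ [ (λ { refl → inj₂ (inj₂ (inj₂ refl)) }) , proj₁ ]′ classify
        (hasSize-⊎ (λ v≡ (_ , v≢) → v≢ v≡) (hasSize-singleton (1# ∷ 0ᵛ)) k) ,
      n≡
      where
        classify : ∀ {v} → Kodd m1 m2 (suc i) v → v ≡ 1# ∷ 0ᵛ ⊎ Kodd⁻ (suc i) v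
        classify {v} k with v ≟ᵛ 1# ∷ 0ᵛ
        ... | yes v≡ = inj₁ v≡
        ... | no  v≢ = inj₂ (k , v≢)

    -- The final cap: no three collinear points

    module Arc (K : PointSet 2) (K-complete : IsCompleteCap K)
               (K-affine : ∀ x1 x2 → ¬ K (0# ∷ x1 ∷ x2 ∷ [])) where

      K⇒x₀≡1 : ∀ {x₀ x₁ x₂} → K (x₀ ∷ x₁ ∷ x₂ ∷ []) → x₀ ≡ 1#
      K⇒x₀≡1 k with proj₁ (proj₁ K-complete) _ k
      ... | inj₁ x₀≡1       = x₀≡1
      ... | inj₂ (refl , _) = ⊥-elim (K-affine _ _ k)

      ConicPair : ∀ s → Vec F (suc (suc (suc (e s)))) → Set
      ConicPair s x = ∃[ ε ] ∃[ α ] (ε ≡ 1# ⊎ ε ≡ 0#) × x ≡ ε ∷ sqVec {suc s} α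

      ArcPart : ∀ s → Vec F (suc (suc (e s))) → Set
      ArcPart s x = ∃[ y₁ ] ∃[ y₂ ] ∃[ α ] K (1# ∷ y₁ ∷ y₂ ∷ []) × x ≡ y₁ ∷ y₂ ∷ sqVec {s} α

      FinalStack : ∀ s → Vec F (suc (suc (suc (suc (e s))))) → Set
      FinalStack s = Stack (ConicPair s) (Stack (ArcPart s) (Kodd⁻ s))

      final⇒stack : ∀ s {v} → FinalCap K m1 m2 s v → FinalStack s v
      final⇒stack s (inj₁ (_ , _ , refl , inj₁ refl , α , refl)) = inj₁ (_ , (1# , α , inj₁ refl , refl) , refl)
      final⇒stack s (inj₁ (_ , _ , refl , inj₂ refl , α , refl)) = inj₁ (_ , (0# , α , inj₂ refl , refl) , refl)
      final⇒stack s (inj₂ (_ , inj₁ (x₀ ∷ x₁ ∷ x₂ ∷ [] , _ , refl , k , α , refl) , refl)) with K⇒x₀≡1 k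
      ... | refl = inj₂ (_ , inj₁ (_ , (x₁ , x₂ , α , k , refl) , refl) , refl)
      final⇒stack s (inj₂ (_ , inj₂ (v , k , v≢ , refl) , refl)) = inj₂ (_ , inj₂ (v , (k , v≢) , refl) , refl)

      conic∈final : ∀ s {ε} {α : Vec F (suc s)} → ε ≡ 1# ⊎ ε ≡ 0# → FinalCap K m1 m2 s (1# ∷ ε ∷ sqVec α)
      conic∈final s (inj₁ refl) = inj₁ (1# ∷ 1# ∷ [] , _ , refl , inj₁ refl , _ , refl)
      conic∈final s (inj₂ refl) = inj₁ (1# ∷ 0# ∷ [] , _ , refl , inj₂ refl , _ , refl)

      arc∈final : ∀ s {x₀ x₁ x₂} {α : Vec F s} → K (x₀ ∷ x₁ ∷ x₂ ∷ []) →
        FinalCap K m1 m2 s (0# ∷ x₀ ∷ x₁ ∷ x₂ ∷ sqVec α)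
      arc∈final s k = inj₂ (_ , inj₁ (_ ∷ _ ∷ _ ∷ [] , _ , refl , k , _ , refl) , refl)

      odd∈final : ∀ s {b} → Kodd⁻ s b → FinalCap K m1 m2 s (0# ∷ 0# ∷ b)
      odd∈final s (k , b≢) = inj₂ (_ , inj₂ (_ , k , b≢ , refl) , refl)

      final-isPointSet : ∀ s → IsPointSet (FinalCap K m1 m2 s)
      final-isPointSet s v f with final⇒stack s f
      ... | inj₁ (_ , _ , refl)                          = inj₁ refl
      ... | inj₂ (_ , inj₁ (_ , _ , refl) , refl)        = inj₂ (refl , inj₁ refl)
      ... | inj₂ (_ , inj₂ (b , (k , _) , refl) , refl)  = inj₂ (refl , inj₂ (refl , odd-isPointSet s b k))

      conicPair-affinelyIndependent : ∀ s → AffinelyIndependent (ConicPair s)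
      conicPair-affinelyIndependent s (ε , α , ε∈ , refl) (ε′ , β , ε′∈ , refl) (ε″ , γ , ε″∈ , refl)
        X≢Y Y≢Z X≢Z a≢0 b≢0 c≢0 sum eq
        with sqVec-independent α β γ a≢0 b≢0 c≢0 sum (proj₂ (∷-injective eq))
      ... | refl , refl = two-values ε∈ ε′∈ ε″∈ (X≢Y ∘ cong (_∷ _)) (Y≢Z ∘ cong (_∷ _)) (X≢Z ∘ cong (_∷ _))

      -- The tails agree, and the vanishing sum of the weights restores the leading coordinate 1, so
      -- a dependency would be one among three points of the arc `K`.
      arcPart-affinelyIndependent : ∀ s → AffinelyIndependent (ArcPart s)
      arcPart-affinelyIndependent s (x₁ , x₂ , α , kX , refl) (y₁ , y₂ , β , kY , refl) (z₁ , z₂ , γ , kZ , refl)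
        X≢Y Y≢Z X≢Z {a} {b} {c} a≢0 b≢0 c≢0 sum eq
        with ∷-injective eq
      ... | p₁ , eq′ with ∷-injective eq′
      ... | p₂ , eq″ with sqVec-independent α β γ a≢0 b≢0 c≢0 sum eq″
      ... | refl , refl = isCap⇒noThree (proj₁ K-complete) kX kY kZ
        (X≢Y ∘ extend) (Y≢Z ∘ extend) (X≢Z ∘ extend) a≢0 b≢0 c≢0
        (cong₂ _∷_
          (trans (solve 3 (λ a b c → a :* con true :+ b :* con true :+ c :* con true := a :+ b :+ c) refl a b c) sum)
          (cong₂ _∷_ p₁ (cong₂ _∷_ p₂ refl)))
        where
          extend : {X Y : Vec F 3} → X ≡ Y → tail X ++ sqVec α ≡ tail Y ++ sqVec α
          extend = cong (λ X → tail X ++ sqVec α)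

      module _ (1∉S∞ : ¬ InS∞ K 1#) (K∩conic : ∀ y1 y2 → K (1# ∷ y1 ∷ y2 ∷ []) → y2 ≢ y1 *ᶠ y1)
               (1∉Sₘ : ¬ (InSm K m1 1# ⊎ InSm K m2 1#)) where

        arcPart-slope : ∀ {x₁ x₂ y₁ y₂ m} → K (1# ∷ x₁ ∷ x₂ ∷ []) → K (1# ∷ y₁ ∷ y₂ ∷ []) →
          x₁ +ᶠ y₁ ≡ 1# *ᶠ 1# → x₂ +ᶠ y₂ ≡ 1# *ᶠ m → InSm K m 1#
        arcPart-slope {m = m} kX kY p₁ p₂ = _ , _ , _ , _ , _ , _ , kX , kY , refl ,
          (λ x≡y → 1≢0 (trans (sym p₁′) (x≡y⇒x+y≡0 x≡y))) ,
          trans p₂ (trans (solve 1 (λ m → con true :* m := m :* con true) refl m) (cong (m *ᶠ_) (sym p₁′))) ,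
          sym p₁′
          where p₁′ = trans p₁ (x*1≡x 1#)

        -- A nonzero conic tail of `Z` forces `c = 1`. Then `(1, m)` as difference of the heads says
        -- that 1 lies in `S_m(K)`, and `(0, 1)` that 1 lies in the set `S∞(K)`. The head `(0, 0)`
        -- falls to `odd-not-parabolic`.
        arcPart-noDirection : ∀ i → NoDirection (ArcPart (suc i)) (Kodd⁻ (suc i))
        arcPart-noDirection i {X} {Y} {Z} (x₁ , x₂ , α , kX , refl) (y₁ , y₂ , β , kY , refl) (k , Z≢) {c} c≢0 p = go k
          where
            heads : ∀ {z₁ z₂ γ} → Z ≡ z₁ ∷ z₂ ∷ γ →
              x₁ +ᶠ y₁ ≡ c *ᶠ z₁ × x₂ +ᶠ y₂ ≡ c *ᶠ z₂ × sqVec (α ⊕ β) ≡ c · γ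
            heads refl with ∷-injective p
            ... | p₁ , p′ with ∷-injective p′
            ... | p₂ , p″ = p₁ , p₂ , trans (sym (sqVec-⊕ α β)) p″

            slope : ∀ {m} {γ : Vec F (suc i)} → NonZeroVec γ → Z ≡ 1# ∷ m ∷ sqVec γ → InSm K m 1#
            slope {γ = γ} γ≢0 Z≡ with heads Z≡
            ... | p₁ , p₂ , p₃ with sqVec-scale (α ⊕ β) γ c≢0 γ≢0 p₃
            ... | refl = arcPart-slope kX kY p₁ p₂

            go : Kodd m1 m2 (suc i) Z → ⊥
            go (inj₁ (γ , γ≢0 , inj₁ Z≡)) = 1∉Sₘ (inj₁ (slope γ≢0 Z≡))
            go (inj₁ (γ , γ≢0 , inj₂ Z≡)) = 1∉Sₘ (inj₂ (slope γ≢0 Z≡))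
            go (inj₂ (inj₁ (γ , γ≢0 , Z≡))) with heads Z≡
            ... | p₁ , p₂ , p₃ with sqVec-scale (α ⊕ β) γ c≢0 γ≢0 p₃
            ... | refl = 1∉S∞ (_ , _ , _ , _ , _ , _ , kX , kY , refl , x+y≡0⇒x≡y (trans p₁ (x*0≡0 1#)) ,
              (λ x≡y → 1≢0 (trans (sym (trans p₂ (x*1≡x 1#))) (x≡y⇒x+y≡0 x≡y))) , sym (trans p₂ (x*1≡x 1#)))
            go (inj₂ (inj₂ (inj₁ (b , k , Z≡)))) =
              odd-not-parabolic i (α ⊕ β) c≢0 k (proj₂ (proj₂ (heads Z≡)))
            go (inj₂ (inj₂ (inj₂ Z≡))) = Z≢ Z≡

        -- Against an arc point, `c` is a nonzero difference of elements of {0, 1}, hence 1. The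
        -- first two tail coordinates then read `y₁ = x + y` and `y₂ = x² + y²`, so the point of `K`
        -- would satisfy `y₂ = y₁²`.
        conicPair-noDirection : ∀ s → NoDirection (ConicPair s) (Stack (ArcPart s) (Kodd⁻ s))
        conicPair-noDirection s (ε , x ∷ α , ε∈ , refl) (ε′ , y ∷ β , ε′∈ , refl)
          (inj₁ (_ , (y₁ , y₂ , γ , k , refl) , refl)) {c} c≢0 p with ∷-injective p
        ... | p₀ , p′ with ∷-injective p′
        ... | p₁ , p″ with ∷-injective p″
        ... | p₂ , _ with c≡1 ε∈ ε′∈ (trans p₀ (x*1≡x c))
          where
            c≡1 : ∀ {ε ε′} → ε ≡ 1# ⊎ ε ≡ 0# → ε′ ≡ 1# ⊎ ε′ ≡ 0# → ε +ᶠ ε′ ≡ c → c ≡ 1#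
            c≡1 (inj₁ refl) (inj₁ refl) r = ⊥-elim (c≢0 (trans (sym r) char2))
            c≡1 (inj₁ refl) (inj₂ refl) r = trans (sym r) (solve 0 (con true :+ con false := con true) refl)
            c≡1 (inj₂ refl) (inj₁ refl) r = trans (sym r) (solve 0 (con false :+ con true := con true) refl)
            c≡1 (inj₂ refl) (inj₂ refl) r =
              ⊥-elim (c≢0 (trans (sym r) (solve 0 (con false :+ con false := con false) refl)))
        ... | refl = K∩conic y₁ y₂ k
          (by₂ (x +ᶠ y +ᶠ y₁) 1# (x≡y⇒x+y≡0 p₁) (x≡y⇒x+y≡0 p₂)
            (solve 4 (λ x y y₁ y₂ → y₂ :+ y₁ :* y₁
              := (x :+ y :+ con true :* y₁) :* (x :+ y :+ y₁)
                 :+ (x :* x :+ y :* y :+ con true :* y₂) :* con true) refl x y y₁ y₂))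
        conicPair-noDirection s (ε , α , ε∈ , refl) (ε′ , β , ε′∈ , refl) (inj₂ (_ , (k , _) , refl)) c≢0 p =
          odd-not-parabolic s (α ⊕ β) c≢0 k (trans (sym (sqVec-⊕ α β)) (proj₂ (∷-injective p)))

        final-isCap : ∀ i → IsCap (FinalCap K m1 m2 (suc i))
        final-isCap i = noThree⇒isCap (final-isPointSet (suc i)) (noThree-⊆ (final⇒stack (suc i))
          (noThree-stack (conicPair-affinelyIndependent (suc i)) (conicPair-noDirection (suc i))
            (noThree-stack (arcPart-affinelyIndependent (suc i)) (arcPart-noDirection i)
              (noThree-⊆ proj₁ (odd-noThree (suc i))))))

      -- The final cap: completeness

      module _ (4<q : 4 < q) (i : ℕ) where

        private
          S : Vec F _ → Set
          S = FinalCap K m1 m2 (suc i)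

          tail≢ : ∀ {n x y} {X Y : Vec F n} → X ≢ Y → x ∷ X ≢ y ∷ Y
          tail≢ X≢Y = X≢Y ∘ proj₂ ∘ ∷-injective

          zero-head : ∀ a b → 0# ≡ a *ᶠ 0# +ᶠ b *ᶠ 0#
          zero-head = solve 2 (λ a b → con false := a :* con false :+ b :* con false) refl

        conic-coverage : ∀ {ε} t → ε ≡ 1# ⊎ ε ≡ 0# → S (1# ∷ ε ∷ t) ⊎ Covered S (1# ∷ ε ∷ t)
        conic-coverage {ε} t ε∈ with parabolic? (suc (suc i)) 1# t
        ... | yes p with parabolic-1⁻ (suc (suc i)) t p
        ... | α , refl = inj₁ (conic∈final (suc i) ε∈)
        conic-coverage {ε} t ε∈ | no ¬p =
          let l , mkSplit α β t≡ _ _ , α≢β = split-affine 4<q (suc (suc i)) t ¬p in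
          inj₂ (_ , _ , conic∈final (suc i) ε∈ , conic∈final (suc i) ε∈ ,
            tail≢ (tail≢ (α≢β ∘ sqVec-injective)) , l , 1# +ᶠ l ,
            cong₂ _∷_ (affine-head l 1#) (cong₂ _∷_ (affine-head l ε) t≡))

        -- The coordinates `(1, p)` dictate the weights `p` and `1 + p` on the heads 1 and 0. Zero
        -- tails are allowed in this layer, so plain `split` suffices.
        affine-coverage : ∀ p t → S (1# ∷ p ∷ t) ⊎ Covered S (1# ∷ p ∷ t)
        affine-coverage p t with p ≟ 1# | p ≟ 0#
        ... | yes p≡1 | _       = conic-coverage t (inj₁ p≡1)
        ... | no _    | yes p≡0 = conic-coverage t (inj₂ p≡0)
        ... | no p≢1  | no p≢0  =
          let α , β , t≡ = split (suc (suc i)) p≢0 (x≢1⇒1+x≢0 p≢1) (λ r → 1≢0 (trans (sym (λ+[1+λ]≡1 p)) r)) t in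
          inj₂ (_ , _ , conic∈final (suc i) {α = α} (inj₁ refl) , conic∈final (suc i) {α = β} (inj₂ refl) ,
            (λ eq → 1≢0 (proj₁ (∷-injective (proj₂ (∷-injective eq))))) , p , 1# +ᶠ p ,
            cong₂ _∷_ (affine-head p 1#) (cong₂ _∷_
              (solve 1 (λ p → p := p :* con true :+ (con true :+ p) :* con false) refl p) t≡))

        arc-coverage : ∀ {y₀ y₁ y₂} t → K (y₀ ∷ y₁ ∷ y₂ ∷ []) →
          S (0# ∷ y₀ ∷ y₁ ∷ y₂ ∷ t) ⊎ Covered S (0# ∷ y₀ ∷ y₁ ∷ y₂ ∷ t)
        arc-coverage {y₀} {y₁} {y₂} t k with parabolic? (suc i) 1# t
        ... | yes p with parabolic-1⁻ (suc i) t p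
        ... | α , refl = inj₁ (arc∈final (suc i) k)
        arc-coverage {y₀} {y₁} {y₂} t k | no ¬p =
          let l , mkSplit α β t≡ _ _ , α≢β = split-affine 4<q (suc i) t ¬p in
          inj₂ (_ , _ , arc∈final (suc i) k , arc∈final (suc i) k ,
            tail≢ (tail≢ (tail≢ (tail≢ (α≢β ∘ sqVec-injective)))) , l , 1# +ᶠ l ,
            cong₂ _∷_ (zero-head l (1# +ᶠ l)) (cong₂ _∷_ (affine-head l y₀) (cong₂ _∷_ (affine-head l y₁)
              (cong₂ _∷_ (affine-head l y₂) t≡))))

        lift-secant : ∀ {y₀ y₁ y₂ t} a b (α β : Vec F (suc i)) → t ≡ (a · sqVec α) ⊕ (b · sqVec β) →
          ∀ {X Y} → K X → K Y → X ≢ Y → y₀ ∷ y₁ ∷ y₂ ∷ [] ≡ (a · X) ⊕ (b · Y) →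
          Covered S (0# ∷ y₀ ∷ y₁ ∷ y₂ ∷ t)
        lift-secant a b α β t≡ {x₀ ∷ x₁ ∷ x₂ ∷ []} {z₀ ∷ z₁ ∷ z₂ ∷ []} kX kY X≢Y refl =
          _ , _ , arc∈final (suc i) {α = α} kX , arc∈final (suc i) {α = β} kY ,
          (λ eq → X≢Y (++-injectiveˡ (x₀ ∷ x₁ ∷ x₂ ∷ []) (z₀ ∷ z₁ ∷ z₂ ∷ []) (proj₂ (∷-injective eq)))) , a , b ,
          cong₂ _∷_ (zero-head a b) (cong₂ _∷_ refl (cong₂ _∷_ refl (cong₂ _∷_ refl t≡)))

        -- The weights of the secant of `K` can be reused for the tail: both are nonzero because the
        -- point is not in `K`, and their sum is 1 because all leading coordinates are 1.
        secant-coverage : ∀ y₁ y₂ t → ¬ K (1# ∷ y₁ ∷ y₂ ∷ []) → Covered K (1# ∷ y₁ ∷ y₂ ∷ []) →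
          Covered S (0# ∷ 1# ∷ y₁ ∷ y₂ ∷ t)
        secant-coverage y₁ y₂ t ¬k (X@(x₀ ∷ x₁ ∷ x₂ ∷ []) , Y@(z₀ ∷ z₁ ∷ z₂ ∷ []) , kX , kY , X≢Y , a , b , P≡) =
          let α , β , t≡ = split (suc i) a≢0 b≢0 a+b≢0 t in lift-secant a b α β t≡ kX kY X≢Y P≡
          where
            P : Vec F 3
            P = 1# ∷ y₁ ∷ y₂ ∷ []
            nP : Normalized P
            nP = inj₁ refl
            pts = proj₁ (proj₁ K-complete)
            a≢0 : a ≢ 0#
            a≢0 refl = ¬k (subst K (sym (normalized-scale nP (pts Y kY)
              (trans P≡ (trans (cong (_⊕ (b · Y)) (0·X≡0 X)) (0⊕X≡X _))))) kY)
            b≢0 : b ≢ 0#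
            b≢0 refl = ¬k (subst K (sym (normalized-scale nP (pts X kX)
              (trans P≡ (trans (cong ((a · X) ⊕_) (0·X≡0 Y)) (X⊕0≡X _))))) kX)
            a+b≢0 : a +ᶠ b ≢ 0#
            a+b≢0 r = 1≢0 (trans (proj₁ (∷-injective P≡))
              (trans (cong₂ (λ x y → a *ᶠ x +ᶠ b *ᶠ y) (K⇒x₀≡1 kX) (K⇒x₀≡1 kY))
                (trans (cong₂ _+ᶠ_ (x*1≡x a) (x*1≡x b)) r)))

        -- Equal weights `c` cancel the leading ones in characteristic 2, and the second point has
        -- zero tail, so `c · sqVec u` remains.
        conicMultiple-coverage : ∀ {b} → Normalized b → ConicMultiple (suc i) b → Covered S (0# ∷ 0# ∷ b)
        conicMultiple-coverage {b} nb (c , u , refl) =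
          1# ∷ 0# ∷ sqVec u , 1# ∷ 0# ∷ sqVec 0ᵛ , conic∈final (suc i) (inj₂ refl) , conic∈final (suc i) (inj₂ refl) ,
          tail≢ (tail≢ λ u≡0 → normalized≢0 nb (trans (cong (c ·_) u≡0) (a·sqVec0≡0 (suc (suc i)) c))) , c , c ,
          cong₂ _∷_ (solve 1 (λ c → con false := c :* con true :+ c :* con true) refl c) (cong₂ _∷_ (zero-head c c)
            (sym (trans (cong ((c · sqVec u) ⊕_) (a·sqVec0≡0 (suc (suc i)) c)) (X⊕0≡X _))))

        final-coverage : ∀ v → Normalized v → ¬ S v → ¬ ¬ Covered S v
        final-coverage (_ ∷ p ∷ t) (inj₁ refl) ¬s ¬cov = [ ¬s , ¬cov ]′ (affine-coverage p t)
        final-coverage (_ ∷ _ ∷ y₁ ∷ y₂ ∷ t) (inj₂ (refl , inj₁ refl)) ¬s ¬cov =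
          complete⇒covered K-complete _ (inj₁ refl) ¬k λ cov → ¬cov (secant-coverage y₁ y₂ t ¬k cov)
          where
            ¬k : ¬ K (1# ∷ y₁ ∷ y₂ ∷ [])
            ¬k k = [ ¬s , ¬cov ]′ (arc-coverage t k)
        final-coverage (_ ∷ _ ∷ b) (inj₂ (refl , inj₂ (refl , nb))) ¬s ¬cov with odd⁻-coverage 4<q i b nb
        ... | inj₁ k = ¬s (odd∈final (suc i) k)
        ... | inj₂ (inj₁ cov) = ¬cov (covered-map (λ X → 0# ∷ 0# ∷ X)
          (λ eq → proj₂ (∷-injective (proj₂ (∷-injective eq)))) (odd∈final (suc i))
          (λ a b X Y → cong₂ _∷_ (zero-head a b) (cong₂ _∷_ (zero-head a b) refl)) cov)
        ... | inj₂ (inj₂ (inj₁ m)) = ¬cov (conicMultiple-coverage nb m)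
        -- The point left out of `Kodd` lies over `(0,1,0)`, which is on the line X₀ = 0 and so not
        -- in `K`; a secant of `K` through it is lifted with zero tails.
        ... | inj₂ (inj₂ (inj₂ refl)) =
          complete⇒covered K-complete (0# ∷ 1# ∷ 0# ∷ []) (inj₂ (refl , inj₁ refl)) (K-affine _ _)
            λ (X , Y , kX , kY , X≢Y , a , b , P≡) → ¬cov (lift-secant a b 0ᵛ 0ᵛ
              (sym (trans (cong₂ _⊕_ (a·sqVec0≡0 (suc i) a)
                (a·sqVec0≡0 (suc i) b)) (X⊕0≡X _))) kX kY X≢Y P≡)

      -- The final cap: size

      conicPair-size : ∀ s → HasSize (ConicPair s) (q ^ suc s + q ^ suc s)
      conicPair-size s = hasSize-⇔
        (λ { (ε , _ , ε∈ , (α , _ , refl) , v≡) → ε , α , ε∈ , v≡ })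
        (λ { (ε , α , ε∈ , v≡) → ε , _ , ε∈ , (α , tt , refl) , v≡ })
        (headed-size 1≢0 (hasSize-image sqVec sqVec-injective (vectors-size (suc s))))

      𝒳-size : ∀ s {k n} → HasSize K k → HasSize (Kodd⁻ s) n → HasSize (𝒳 K m1 m2 s) (k * q ^ s + n)
      𝒳-size s sK sOdd = hasSize-⇔
        (λ { (inj₁ ((X , α) , (k , _) , w≡)) → inj₁ (X , sqVec α , w≡ , k , α , refl)
           ; (inj₂ (b , (k , b≢) , w≡)) → inj₂ (b , k , b≢ , w≡) })
        (λ { (inj₁ (X , _ , w≡ , k , α , refl)) → inj₁ ((X , α) , (k , tt) , w≡)
           ; (inj₂ (b , k , b≢ , w≡)) → inj₂ (b , (k , b≢) , w≡) })
        (hasSize-⊎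
          (λ { (((x₀ ∷ x₁ ∷ x₂ ∷ []) , α) , (k , _) , refl) (b , _ , p) →
               1≢0 (trans (sym (K⇒x₀≡1 k)) (proj₁ (∷-injective p))) })
          (hasSize-image (λ (X , α) → X ++ sqVec α)
            (λ { {X , α} {Y , β} p → let p₀ , p₁ = ++-injective X Y p in cong₂ _,_ p₀ (sqVec-injective p₁) })
            (hasSize-× sK (vectors-size s)))
          (hasSize-image (0# ∷_) (proj₂ ∘ ∷-injective) sOdd))

      final-size : ∀ i {k} → HasSize K k → ∃[ n ] HasSize (FinalCap K m1 m2 (suc i)) n ×
        n + (2 * suc i + 3) ≡ 2 * q ^ (suc i + 1) + (k + 3) * q ^ suc i + 3 * sumPow q i + 4
      final-size i {k} sK = let n , sOdd , n≡ = odd⁻-size i in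
        _ ,
        hasSize-⇔
          (λ { (inj₁ (_ , (_ , _ , ε∈ , refl) , refl)) → conic∈final (suc i) ε∈ ; (inj₂ x) → inj₂ x })
          (λ { (inj₁ (_ , _ , refl , inj₁ refl , α , refl)) → inj₁ (_ , (1# , α , inj₁ refl , refl) , refl)
             ; (inj₁ (_ , _ , refl , inj₂ refl , α , refl)) → inj₁ (_ , (0# , α , inj₂ refl , refl) , refl)
             ; (inj₂ x) → inj₂ x })
          (stack-size (conicPair-size (suc i)) (𝒳-size (suc i) sK sOdd)) ,
        final-count (suc i) k n (q ^ suc i) (q ^ suc (suc i)) (sumPow q i) (cong (q ^_) (ℕ.+-comm 1 (suc i))) n≡

theorem4p4 : (s q k : ℕ) → 1 ≤ s → (∃[ h ] q ≡ 2 ^ h) → 8 < q →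
    (𝔽 : FiniteField2 q) →
    let open Geometry 𝔽 in
    (K : PointSet 2) → IsCompleteCap K → HasSize K k →
    (∀ x1 x2 → ¬ K (0# ∷ x1 ∷ x2 ∷ [])) →
    k + 5 < q →
    ¬ InS∞ K 1# →
    (∀ y1 y2 → K (1# ∷ y1 ∷ y2 ∷ []) → y2 ≢ y1 *ᶠ y1) →
    (m1 m2 : F) → m1 ≢ 0# → m2 ≢ 0# → m1 ≢ m2 →
    ((m1 +ᶠ m2) *ᶠ ((m1 +ᶠ m2) *ᶠ (m1 +ᶠ m2)) ≢ 1#) →
    m1 ≢ 1# → m2 ≢ 1# →
    ¬ (InSm K m1 1# ⊎ InSm K m2 1#) →
    IsCompleteCap (FinalCap K m1 m2 s) ×
    (∃[ n ] HasSize (FinalCap K m1 m2 s) n ×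
      (n + (2 * s + 3) ≡ 2 * q ^ (s + 1) + (k + 3) * q ^ s + 3 * sumPow q (s ∸ 1) + 4))
theorem4p4 (suc i) q k _ _ 8<q 𝔽 K K-complete K-size K-affine _ 1∉S∞ K∩conic m1 m2 m1≢0 m2≢0 m1≢m2 μ³≢1 m1≢1 m2≢1 1∉Sₘ =
  -- The enumeration behind the size also makes membership in the cap decidable.
  complete-from-coverage (final-isCap 1∉S∞ K∩conic 1∉Sₘ i) (hasSize⇒dec _≟ᵛ_ (proj₁ (proj₂ size)))
    (final-coverage (ℕ.≤-trans (ℕ.m≤n+m 5 4) 8<q) i) ,
  size
  where
    open Vectors 𝔽
    open OddCap.Slopes 𝔽 m1 m2 m1≢0 m2≢0 m1≢m2 μ³≢1 m1≢1 m2≢1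
    open Arc K K-complete K-affine
    size = final-size i K-size
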